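{- For $v,w\in W_{af}$ define $\psi^v(w)=\sum_{\varepsilon:\ |\varepsilon|=\ell(v),\ w^\varepsilon=v}\Psi^\varepsilon_\gamma\in\mathbb{Z}[\alpha_0,\dots,\alpha_{n-1}]$, where $\gamma$ is any (not necessarily minimal) alcove walk from $\mathbf{a}_0$ to $\mathbf{w}$ (this is independent of the choice of $\gamma$; an empty sum is $0$, and for $w=e$ one may take the trivial walk with the empty mask, giving $\psi^e(e)=1$). Then for all $v,w\in W_{af}$ and every $\beta\in R_{af}$, \[ \beta \ \text{ divides } \ \psi^v(w)-\psi^v(s_\beta w)\quad\text{in } \mathbb{Z}[\alpha_0,\dots,\alpha_{n-1}], \] where $s_\beta\in W_{af}$ is the reflection associated to $\beta$.
   Context: Let $(I_{af},A_{af})$ be an affine Cartan datum with generalized Cartan matrix $A_{af}=(a_{ij})$, $|I_{af}|=n$, $0\in I_{af}$, $I_0=I_{af}\setminus\{0\}$. The affine Weyl group $W_{af}$ is generated by $s_i$, $i\in I_{af}$, with relations $s_i^2=1$, $(s_is_j)^{m_{ij}}=1$ (where $m_{ij}=2,3,4,6$ according as $a_{ij}a_{ji}=0,1,2,3$); $\ell$ denotes Coxeter length. Simple affine roots $\alpha_i$ and coroots $\alpha_i^\vee$ satisfy $\langle\alpha_i^\vee,\alpha_j\rangle=a_{ij}$, and $W_{af}$ acts on the root lattice by $s_i\mu=\mu-\langle\alpha_i^\vee,\mu\rangle\alpha_i$. The real affine roots are $R_{af}=\{u\alpha_i: u\in W_{af}, i\in I_{af}\}$, with $R^+_{af}=R_{af}\cap\sum_i\mathbb{Z}_{\ge0}\alpha_i$,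 $R^-_{af}=-R^+_{af}$. For $\beta=u\alpha_i$, $s_\beta=us_iu^{ -1}$. Let $R$ be the finite root system of $(I_0,A_0)$ with highest root $\theta$, and $\delta=\alpha_0+\theta$; then $R_{af}=\{\alpha+k\delta:\alpha\in R,k\in\mathbb{Z}\}$. Products of affine roots are regarded in $\mathbb{Z}[\alpha_0,\dots,\alpha_{n-1}]$ via $\delta=\alpha_0+\theta$. Geometry: $V^*=X^\vee\otimes\mathbb{R}$; $H_{\alpha+k\delta}=\{x:\langle x,\alpha\rangle=k\}$; $W_{af}$ acts on $V^*$ with $s_\beta$ the reflection across $H_\beta$. Alcoves are closures of components of the complement of all these hyperplanes; the base alcove $\mathbf{a}_0$ has walls $H_{\alpha_i}$, $i\in I_{af}$; $w\in W_{af}$ is identified with $\mathbf{w}=w\mathbf{a}_0$. The alcoves $u\mathbf{a}_0$ and $us_i\mathbf{a}_0$ share a panel of type $i$ lying in $H_{u\alpha_i}$. An alcove walk $\gamma=(\mathbf{a}_0,\dots,\mathbf{a}_m)$ is a sequence of alcoves, consecutive ones distinct and sharing a panel; if $\mathbf{a}_{j-1}=u\mathbf{a}_0$ and $\mathbf{a}_j=us_{i_j}\mathbf{a}_0$ then $\operatorname{type}(\gamma)=s_{i_1}\cdots s_{i_m}$ and $\gamma$ ends at $\mathbf{w}$ with $w=s_{i_1}\cdots s_{i_m}$. Step $j$ is forward if $\ell(u)<\ell(us_{i_j})$, backward otherwise, and is labelled by $\beta_j\in\{\pm u\alpha_{i_j}\}$ taken in $R^+_{af}$ for forward and $R^-_{af}$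 for backward steps. A mask is $\varepsilon\in\{0,1\}^m$, $|\varepsilon|$ its number of $1$'s, $w^\varepsilon=s_{i_1}^{\varepsilon_1}\cdots s_{i_m}^{\varepsilon_m}$, and $\Psi^\varepsilon_\gamma=\prod_{\varepsilon_j=1}\beta_j$ (empty product $1$). -}

module Defs where

open import Data.Nat as ℕ using (ℕ; zero; suc)
open import Data.Integer as ℤ using (ℤ; +_; -_; _+_; _-_; _*_; ∣_∣)
open import Data.Fin as Fin using (Fin; zero; suc)
open import Data.Fin.Properties using () renaming (_≟_ to _≟F_)
open import Data.List using (List; []; _∷_; _++_; length; replicate; concat; concatMap; map; foldr; reverse; upTo)
open import Data.Maybe using (Maybe; just; nothing)
open import Data.Bool using (Bool; true; false; if_then_else_; _∧_)
open import Data.Unit using (⊤)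
open import Data.Empty using (⊥)
open import Data.Product using (Σ; ∃; ∃₂; _×_; _,_)
open import Data.Sum using (_⊎_)
open import Data.Vec.Functional as VF using (Vector)
open import Relation.Nullary using (¬_; does)
open import Relation.Binary.PropositionalEquality using (_≡_; _≢_; _≗_)

sumFin : ∀ n → (Fin n → ℤ) → ℤ
sumFin zero    f = + 0
sumFin (suc n) f = f zero + sumFin n (λ i → f (suc i))

sumList : List ℤ → ℤ
sumList = foldr _+_ (+ 0)

-- Root lattice  ⊕_{i} ℤ α_i  (coordinates w.r.t. the simple roots)

Lattice : ℕ → Set
Lattice n = Fin n → ℤ

e : ∀ {n} → Fin n → Lattice n
e i j = if does (i ≟F j) then + 1 else + 0

negL : ∀ {n} → Lattice n → Lattice n
negL μ j = - (μ j)

Matrix : ℕ → Set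
Matrix n = Fin n → Fin n → ℤ

-- ⟨α_i^∨ , μ⟩ = Σ_j a_ij μ_j
pair : ∀ {n} → Matrix n → Fin n → Lattice n → ℤ
pair {n} A i μ = sumFin n (λ j → A i j * μ j)

sRefl : ∀ {n} → Matrix n → Fin n → Lattice n → Lattice n
sRefl A i μ j = μ j - pair A i μ * e i j

Nonneg : ∀ {n} → Lattice n → Set
Nonneg μ = ∀ j → + 0 ℤ.≤ μ j

Nonpos : ∀ {n} → Lattice n → Set
Nonpos μ = ∀ j → μ j ℤ.≤ + 0

IsGCM : ∀ {n} → Matrix n → Set
IsGCM A = (∀ i → A i i ≡ + 2)
        × (∀ i j → i ≢ j → A i j ℤ.≤ + 0)
        × (∀ i j → A i j ≡ + 0 → A j i ≡ + 0)

Indecomposable : ∀ {n} → Matrix n → Set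
Indecomposable A = ∀ (S : Fin _ → Bool) → (∃ λ i → S i ≡ true) → (∃ λ j → S j ≡ false)
  → ∃₂ λ i j → S i ≡ true × S j ≡ false × A i j ≢ + 0

-- affine type: indecomposable GCM with a null vector u > 0 (Kac, Thm 4.3)
IsAffineGCM : ∀ {n} → Matrix n → Set
IsAffineGCM {n} A = IsGCM A × Indecomposable A
  × ∃ λ (u : Lattice n) → (∀ j → + 0 ℤ.< u j) × (∀ i → pair A i u ≡ + 0)

-- Real roots of the finite root system R of (I_0, A_0), I_0 = I_af ∖ {0}
-- (node 0 is Fin.zero): generated from α_i (i ≠ 0) by the s_i (i ≠ 0).
data FinRoot {m : ℕ} (A : Matrix (suc m)) : Lattice (suc m) → Set where
  simple : ∀ (i : Fin m) → FinRoot A (e (suc i))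
  reflect : ∀ (i : Fin m) {μ} → FinRoot A μ → FinRoot A (sRefl A (suc i) μ)

HighestRoot : ∀ {m} → Matrix (suc m) → Lattice (suc m) → Set
HighestRoot A θ = FinRoot A θ × (∀ β → FinRoot A β → ∀ j → β j ℤ.≤ θ j)

deltaOf : ∀ {m} → Lattice (suc m) → Lattice (suc m)
deltaOf θ j = e zero j + θ j

AffineCartanDatum : ∀ {m} → Matrix (suc m) → Set
AffineCartanDatum A = IsAffineGCM A
  × ∃ λ θ → HighestRoot A θ × (∀ i → pair A i (deltaOf θ) ≡ + 0)

-- The affine Weyl group by its Coxeter presentation.
-- Elements are represented by words in the generators; a word
-- i₁ ∷ … ∷ iₘ ∷ [] stands for s_{i₁} ⋯ s_{iₘ}.

Word : ℕ → Set
Word n = List (Fin n)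

-- m_ij according as a_ij a_ji = 0,1,2,3 (otherwise m_ij = ∞: no relation)
coxM : ℕ → Maybe ℕ
coxM 0 = just 2
coxM 1 = just 3
coxM 2 = just 4
coxM 3 = just 6
coxM _ = nothing

data Relator {n} (A : Matrix n) : Word n → Set where
  square : ∀ i → Relator A (i ∷ i ∷ [])
  braid  : ∀ i j k → i ≢ j → coxM ∣ A i j * A j i ∣ ≡ just k
         → Relator A (concat (replicate k (i ∷ j ∷ [])))

data Equiv {n} (A : Matrix n) : Word n → Word n → Set where
  rel   : ∀ u v {r} → Relator A r → Equiv A (u ++ r ++ v) (u ++ v)
  refl  : ∀ {x} → Equiv A x x
  sym   : ∀ {x y} → Equiv A x y → Equiv A y x
  trans : ∀ {x y z} → Equiv A x y → Equiv A y z → Equiv A x z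

IsLength : ∀ {n} → Matrix n → Word n → ℕ → Set
IsLength A w k = (∃ λ u → Equiv A u w × length u ≡ k)
               × (∀ u → Equiv A u w → k ℕ.≤ length u)

act : ∀ {n} → Matrix n → Word n → Lattice n → Lattice n
act A []      μ = μ
act A (i ∷ w) μ = sRefl A i (act A w μ)

-- the word  u s_i u^{-1}  (= s_β for β = u α_i)
reflWord : ∀ {n} → Word n → Fin n → Word n
reflWord u i = u ++ i ∷ reverse u

-- Alcove walks from a₀, given by their type (a word);
-- the walk of type γ ends at the alcove of the element represented by γ.

-- step from u a₀ to u s_i a₀ is forward iff ℓ(u) < ℓ(u s_i)
Forward : ∀ {n} → Matrix n → Word n → Fin n → Set
Forward A u i = ∀ k k' → IsLength A u k → IsLength A (u ++ i ∷ []) k' → k ℕ.< k'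

IsLabel : ∀ {n} → Matrix n → Word n → Fin n → Lattice n → Set
IsLabel A u i β = (β ≗ act A u (e i) ⊎ β ≗ negL (act A u (e i)))
                × (Forward A u i → Nonneg β)
                × (¬ Forward A u i → Nonpos β)

data LabelsFrom {n} (A : Matrix n) : Word n → Word n → List (Lattice n) → Set where
  done : ∀ {p} → LabelsFrom A p [] []
  step : ∀ {p i r β bs} → IsLabel A p i β → LabelsFrom A (p ++ i ∷ []) r bs
       → LabelsFrom A p (i ∷ r) (β ∷ bs)

Labels : ∀ {n} → Matrix n → Word n → List (Lattice n) → Set
Labels A γ bs = LabelsFrom A [] γ bs

-- Polynomials in ℤ[α_0,…,α_{n-1}] : finitely supported coefficient
-- functions on exponent vectors.

Exp : ℕ → Set
Exp n = Fin n → ℕ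

Poly : ℕ → Set
Poly n = Exp n → ℤ

FinSupp : ∀ {n} → Poly n → Set
FinSupp p = ∃ λ D → ∀ m → (∃ λ j → D ℕ.< m j) → p m ≡ + 0

eqExp : ∀ {n} → Exp n → Exp n → Bool
eqExp {zero}  a b = true
eqExp {suc n} a b = does (a zero ℕ.≟ b zero) ∧ eqExp {n} (VF.tail a) (VF.tail b)

isZeroExp : ∀ {n} → Exp n → Bool
isZeroExp a = eqExp a (λ _ → 0)

unitExp : ∀ {n} → Fin n → Exp n
unitExp i j = if does (i ≟F j) then 1 else 0

zeroP : ∀ {n} → Poly n
zeroP _ = + 0

oneP : ∀ {n} → Poly n
oneP m = if isZeroExp m then + 1 else + 0

linP : ∀ {n} → Lattice n → Poly n
linP {n} μ m = sumFin n (λ j → if eqExp m (unitExp j) then μ j else + 0)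

_⊕_ : ∀ {n} → Poly n → Poly n → Poly n
(p ⊕ q) m = p m + q m

_⊖_ : ∀ {n} → Poly n → Poly n → Poly n
(p ⊖ q) m = p m - q m

below : ∀ n → Exp n → List (Exp n)
below zero    m = (λ ()) ∷ []
below (suc n) m = concatMap (λ k → map (λ a → k VF.∷ a) (below n (VF.tail m))) (upTo (suc (m zero)))

_⊛_ : ∀ {n} → Poly n → Poly n → Poly n
(_⊛_ {n} p q) m = sumList (map (λ a → p a * q (λ j → m j ℕ.∸ a j)) (below n m))

Divides : ∀ {n} → Lattice n → Poly n → Set
Divides β f = ∃ λ q → FinSupp q × (∀ m → f m ≡ (linP β ⊛ q) m)

allMasks : ℕ → List (List Bool)
allMasks zero    = [] ∷ []
allMasks (suc k) = concatMap (λ ε → (false ∷ ε) ∷ (true ∷ ε) ∷ []) (allMasks k)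

maskWord : ∀ {n} → Word n → List Bool → Word n
maskWord (i ∷ γ) (true  ∷ ε) = i ∷ maskWord γ ε
maskWord (i ∷ γ) (false ∷ ε) = maskWord γ ε
maskWord _       _           = []

weight : List Bool → ℕ
weight []          = 0
weight (true ∷ ε)  = suc (weight ε)
weight (false ∷ ε) = weight ε

PsiMask : ∀ {n} → List (Lattice n) → List Bool → Poly n
PsiMask (β ∷ bs) (true  ∷ ε) = linP β ⊛ PsiMask bs ε
PsiMask (β ∷ bs) (false ∷ ε) = PsiMask bs ε
PsiMask _        _           = oneP

data SumRel {n} (A : Matrix n) (γ : Word n) (bs : List (Lattice n)) (v : Word n) (k : ℕ)
     : List (List Bool) → Poly n → Set where
  nil  : SumRel A γ bs v k [] zeroP
  take : ∀ {ε εs p} → weight ε ≡ k → Equiv A (maskWord γ ε) v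
       → SumRel A γ bs v k εs p → SumRel A γ bs v k (ε ∷ εs) (PsiMask bs ε ⊕ p)
  skip : ∀ {ε εs p} → ¬ (weight ε ≡ k × Equiv A (maskWord γ ε) v)
       → SumRel A γ bs v k εs p → SumRel A γ bs v k (ε ∷ εs) p

-- PsiSum A γ bs v k p : p = ψ^v computed along the walk γ with labels bs,
-- where k = ℓ(v)
PsiSum : ∀ {n} → Matrix n → Word n → List (Lattice n) → Word n → ℕ → Poly n → Set
PsiSum A γ bs v k p = SumRel A γ bs v k (allMasks (length γ)) p

{-# OPTIONS --safe #-}
-- The labels of a walk are always the roots β_j = p α_{i_j}, p the alcove before step j: a step
-- is forward exactly when p α_i is positive.  Hence ψ^v is read off from the product of the
-- factors 1 + β_j T_{i_j} in the nil-Coxeter algebra with polynomial coefficients.  This product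
-- does not change when a relator is deleted from the walk: (1 + β T)(1 − β T) = 1 handles the
-- squares, and the Yang–Baxter equations in the rank 2 systems A₁×A₁, A₂, B₂, G₂ the braid
-- relators.  So the walks to w and to s_β w, where β = u α_i, may be taken to be u u⁻¹ w and
-- u s_i u⁻¹ w.  Modulo β, the masks using the letter s_i contribute 0, and all other labels
-- agree because s_β μ ≡ μ.
module Submission where

open import Defs
open import Data.Nat using (ℕ; suc)
open import Data.Integer using (ℤ)
open import Data.Fin using (Fin)
open import Data.List using (List; _++_)
open import Data.Nat using (zero)
import Data.Nat as ℕ
import Data.Nat.Properties as ℕ
open import Data.Integer using (+_; -_; _+_; _-_; _*_; ∣_∣)
import Data.Integer as ℤ
import Data.Integer.Properties as ℤ
open import Data.Integer.Tactic.RingSolver using (solve-∀)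
open import Data.Fin using (zero; suc)
open import Data.Fin.Properties using (all?) renaming (_≟_ to _≟F_)
open import Data.Bool using (Bool; true; false; if_then_else_; _∧_; _∨_)
import Data.Bool.Properties as Bool
open import Data.List using ([]; _∷_; reverse; length; map; concat; concatMap; replicate; applyUpTo; initLast; _∷ʳ′_)
open import Data.List.Properties using (++-assoc; ++-identityʳ; length-++; map-++; unfold-reverse; reverse-involutive)
import Data.List.Properties as List
open import Data.List.Relation.Unary.All using (All; []; _∷_)
open import Data.Vec using (Vec; []; _∷_; lookup; tabulate)
open import Data.Vec.Properties using (lookup∘tabulate)
import Data.Vec.Functional as VF
open import Data.Maybe using (Maybe; just; nothing)
open import Data.Maybe.Properties using (just-injective)
open import Data.Product using (∃; _×_; _,_; proj₁; proj₂)
import Data.Product.Properties as Product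
open import Data.Sum using (_⊎_; inj₁; inj₂)
open import Data.Empty using (⊥)
open import Function using (_⇔_; mk⇔)
open import Relation.Nullary using (Dec; does; yes; no; ¬_; contradiction)
open import Relation.Nullary.Decidable using (map′; from-yes; _×-dec_; does-⇔; dec-true; dec-false)
open import Relation.Binary.PropositionalEquality as ≡ using (_≡_; _≢_; _≗_; refl; cong; cong₂; subst; subst₂)

-- The nil-Coxeter algebra is never built. `expand` pairs the product of the factors 1 + β T with a
-- function `φ` on words, and `NilCoxeter φ` says that `φ` descends to the algebra. If |ε| = ℓ(v)
-- and w^ε = v, the chosen letters form a reduced word of v, so ψ^v is the pairing with the
-- indicator `χ` of such words. Two facts about a group known only by its presentation are then
-- needed: `χ` has to be a function, which takes a solution of the word problem, and the direction
-- of a step has to fix the sign of its label. Both come from one dichotomy, `Sign`: w α_i is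
-- nonnegative, or it is nonpositive and w s_i has a word shorter than `w`. It is proved by
-- induction on words through cosets of rank 2 subgroups, without a prior length function.

-- Words modulo the Coxeter relations

module _ {n : ℕ} (A : Matrix n) where

  ≡⇒~ : ∀ {x y} → x ≡ y → Equiv A x y
  ≡⇒~ refl = refl

  ~-++ˡ : ∀ a {x y} → Equiv A x y → Equiv A (a ++ x) (a ++ y)
  ~-++ˡ a (rel u v {r} R) =
    subst₂ (Equiv A) (++-assoc a u (r ++ v)) (++-assoc a u v) (rel (a ++ u) v R)
  ~-++ˡ a refl        = refl
  ~-++ˡ a (sym p)     = sym (~-++ˡ a p)
  ~-++ˡ a (trans p q) = trans (~-++ˡ a p) (~-++ˡ a q)

  ~-++ʳ : ∀ b {x y} → Equiv A x y → Equiv A (x ++ b) (y ++ b)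
  ~-++ʳ b (rel u v {r} R) = subst₂ (Equiv A)
    (≡.sym (≡.trans (++-assoc u (r ++ v) b) (cong (u ++_) (++-assoc r v b))))
    (≡.sym (++-assoc u v b)) (rel u (v ++ b) R)
  ~-++ʳ b refl        = refl
  ~-++ʳ b (sym p)     = sym (~-++ʳ b p)
  ~-++ʳ b (trans p q) = trans (~-++ʳ b p) (~-++ʳ b q)

  cancel-square : ∀ u i v → Equiv A (u ++ i ∷ i ∷ v) (u ++ v)
  cancel-square u i v = rel u v (square i)

  cancel-reverseʳ : ∀ u v → Equiv A (u ++ reverse u ++ v) v
  cancel-reverseʳ []      v = refl
  cancel-reverseʳ (i ∷ u) v = trans
    (≡⇒~ (cong (λ z → i ∷ u ++ z)
      (≡.trans (cong (_++ v) (unfold-reverse i u)) (++-assoc (reverse u) (i ∷ []) v))))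
    (trans (~-++ˡ (i ∷ []) (cancel-reverseʳ u (i ∷ v))) (cancel-square [] i v))

  cancel-reverseˡ : ∀ u v → Equiv A (reverse u ++ u ++ v) v
  cancel-reverseˡ u v = subst (λ z → Equiv A (reverse u ++ z ++ v) v)
    (reverse-involutive u) (cancel-reverseʳ (reverse u) v)

  quotient⇒~ : ∀ u v → Equiv A (u ++ reverse v) [] → Equiv A u v
  quotient⇒~ u v p = trans
    (sym (trans (~-++ˡ u (≡⇒~ (≡.sym (++-identityʳ (reverse v ++ v)))))
       (trans (≡⇒~ (cong (u ++_) (++-assoc (reverse v) v [])))
         (trans (~-++ˡ u (cancel-reverseˡ v [])) (≡⇒~ (++-identityʳ u))))))
    (trans (≡⇒~ (≡.sym (++-assoc u (reverse v) v))) (~-++ʳ v p))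

  ~⇒quotient : ∀ u v → Equiv A u v → Equiv A (u ++ reverse v) []
  ~⇒quotient u v p = trans (~-++ʳ (reverse v) p)
    (trans (≡⇒~ (cong (v ++_) (≡.sym (++-identityʳ (reverse v))))) (cancel-reverseʳ v []))

  ~-snoc-swap : ∀ x v i → Equiv A x (v ++ i ∷ []) → Equiv A v (x ++ i ∷ [])
  ~-snoc-swap x v i p = sym (trans (~-++ʳ (i ∷ []) p)
    (trans (≡⇒~ (++-assoc v (i ∷ []) (i ∷ [])))
      (trans (cancel-square v i []) (≡⇒~ (++-identityʳ v)))))

-- Linearity of the action on the root lattice

sumFin-cong : ∀ n {f g : Fin n → ℤ} → f ≗ g → sumFin n f ≡ sumFin n g
sumFin-cong zero    p = refl
sumFin-cong (suc n) p = cong₂ _+_ (p zero) (sumFin-cong n (λ i → p (suc i)))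

sumFin-0 : ∀ n → sumFin n (λ _ → + 0) ≡ + 0
sumFin-0 zero    = refl
sumFin-0 (suc n) = ≡.trans (ℤ.+-identityˡ _) (sumFin-0 n)

private
  regroup : ∀ (a b x y u v : ℤ) → (a * x + b * y) + (a * u + b * v) ≡ a * (x + u) + b * (y + v)
  regroup = solve-∀

  comb-0 : ∀ (a b : ℤ) → + 0 ≡ a * + 0 + b * + 0
  comb-0 = solve-∀

sumFin-comb : ∀ n a b (f g : Fin n → ℤ) →
  sumFin n (λ i → a * f i + b * g i) ≡ a * sumFin n f + b * sumFin n g
sumFin-comb zero    a b f g = comb-0 a b
sumFin-comb (suc n) a b f g =
  ≡.trans (cong (λ z → (a * f zero + b * g zero) + z) (sumFin-comb n a b (λ i → f (suc i)) (λ i → g (suc i))))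
    (regroup a b (f zero) (g zero) _ _)

sumFin-e : ∀ n (f : Fin n → ℤ) k → sumFin n (λ j → f j * e k j) ≡ f k
sumFin-e (suc n) f zero = ≡.trans
  (cong₂ _+_ (ℤ.*-identityʳ (f zero))
    (≡.trans (sumFin-cong n (λ j → ℤ.*-zeroʳ (f (suc j)))) (sumFin-0 n)))
  (ℤ.+-identityʳ (f zero))
sumFin-e (suc n) f (suc k) = ≡.trans
  (cong₂ _+_ (ℤ.*-zeroʳ (f zero)) (sumFin-e n (λ j → f (suc j)) k)) (ℤ.+-identityˡ _)

comb : ∀ {n} → ℤ → Lattice n → ℤ → Lattice n → Lattice n
comb a μ b ν j = a * μ j + b * ν j

module _ {n : ℕ} (A : Matrix n) where

  pair-cong : ∀ i {μ ν} → μ ≗ ν → pair A i μ ≡ pair A i ν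
  pair-cong i p = sumFin-cong n (λ j → cong (A i j *_) (p j))

  private
    pull : ∀ (c a x b y : ℤ) → c * (a * x + b * y) ≡ a * (c * x) + b * (c * y)
    pull = solve-∀

  pair-comb : ∀ i a μ b ν → pair A i (comb a μ b ν) ≡ a * pair A i μ + b * pair A i ν
  pair-comb i a μ b ν = ≡.trans (sumFin-cong n (λ j → pull (A i j) a (μ j) b (ν j)))
    (sumFin-comb n a b _ _)

  pair-e : ∀ i k → pair A i (e k) ≡ A i k
  pair-e i k = sumFin-e n (A i) k

  sRefl-cong : ∀ i {μ ν} → μ ≗ ν → sRefl A i μ ≗ sRefl A i ν
  sRefl-cong i p j = cong₂ (λ x c → x - c * e i j) (p j) (pair-cong i p)

  private
    sRefl-comb′ : ∀ (a x b y P Q E : ℤ) →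
      (a * x + b * y) - (a * P + b * Q) * E ≡ a * (x - P * E) + b * (y - Q * E)
    sRefl-comb′ = solve-∀

  sRefl-comb : ∀ i a μ b ν → sRefl A i (comb a μ b ν) ≗ comb a (sRefl A i μ) b (sRefl A i ν)
  sRefl-comb i a μ b ν j = ≡.trans
    (cong (λ c → comb a μ b ν j - c * e i j) (pair-comb i a μ b ν))
    (sRefl-comb′ a (μ j) b (ν j) _ _ (e i j))

  act-cong : ∀ w {μ ν} → μ ≗ ν → act A w μ ≗ act A w ν
  act-cong []      p = p
  act-cong (i ∷ w) p = sRefl-cong i (act-cong w p)

  act-comb : ∀ w a μ b ν → act A w (comb a μ b ν) ≗ comb a (act A w μ) b (act A w ν)
  act-comb []      a μ b ν j = refl
  act-comb (i ∷ w) a μ b ν j = ≡.trans (sRefl-cong i (act-comb w a μ b ν) j)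
    (sRefl-comb i a (act A w μ) b (act A w ν) j)

  act-++ : ∀ u w μ → act A (u ++ w) μ ≡ act A u (act A w μ)
  act-++ []      w μ = refl
  act-++ (i ∷ u) w μ = cong (sRefl A i) (act-++ u w μ)

-- Rank 2 types, and the action of the presented group

-- The matrix entries (- a, - b) and exponents m of the finite rank 2 root systems.
data Rank2 : ℕ → ℕ → ℕ → Set where
  A₁×A₁ : Rank2 0 0 2
  A₂    : Rank2 1 1 3
  B₂    : Rank2 1 2 4
  C₂    : Rank2 2 1 4
  G₂    : Rank2 1 3 6
  G₂′   : Rank2 3 1 6

coxM-large : ∀ {c} → 4 ℕ.≤ c → coxM c ≡ nothing
coxM-large (ℕ.s≤s (ℕ.s≤s (ℕ.s≤s (ℕ.s≤s _)))) = refl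

coxM-nothing : ∀ c → coxM c ≡ nothing → 4 ℕ.≤ c
coxM-nothing (suc (suc (suc (suc c)))) _ = ℕ.s≤s (ℕ.s≤s (ℕ.s≤s (ℕ.s≤s ℕ.z≤n)))

-- A lone zero entry is excluded by hypothesis, so a product of at most 3 leaves only the listed
-- factorisations. All other pairs have product at least 4, where `coxM` gives no exponent.
classify : ∀ a b k → (a ≡ 0 → b ≡ 0) → (b ≡ 0 → a ≡ 0) →
  coxM (a ℕ.* b) ≡ just k → Rank2 a b k
classify zero b k h h′ p with h refl | p
... | refl | refl = A₁×A₁
classify (suc a) zero k h h′ p with h′ refl
... | ()
classify 1 1 k h h′ refl = A₂
classify 1 2 k h h′ refl = B₂
classify 1 3 k h h′ refl = G₂
classify 2 1 k h h′ refl = C₂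
classify 3 1 k h h′ refl = G₂′
classify 2 (suc (suc b)) k h h′ p =
  contradiction (≡.trans (≡.sym p) (coxM-large (ℕ.*-mono-≤ {2} {2} {2} ℕ.≤-refl (ℕ.s≤s (ℕ.s≤s ℕ.z≤n))))) λ ()
classify 3 (suc (suc b)) k h h′ p =
  contradiction (≡.trans (≡.sym p) (coxM-large (ℕ.*-mono-≤ {2} {3} {2}
    (ℕ.s≤s (ℕ.s≤s ℕ.z≤n)) (ℕ.s≤s (ℕ.s≤s ℕ.z≤n))))) λ ()
classify (suc (suc (suc (suc a)))) (suc b) k h h′ p =
  contradiction (≡.trans (≡.sym p) (coxM-large (ℕ.*-mono-≤ {4} {4 ℕ.+ a} {1} (ℕ.m≤m+n 4 a) (ℕ.s≤s ℕ.z≤n)))) λ ()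

module GCM {n : ℕ} (A : Matrix n) (gcm : IsGCM A) where

  negate : ∀ x → x ℤ.≤ + 0 → x ≡ - (+ ∣ x ∣)
  negate (+ zero)    _ = refl
  negate (ℤ.-[1+ k ]) _ = refl
  negate (+ suc k) (ℤ.+≤+ ())

  offdiag : ∀ i j → i ≢ j → A i j ≡ - (+ ∣ A i j ∣)
  offdiag i j i≢j = negate (A i j) (proj₁ (proj₂ gcm) i j i≢j)

  rank2 : ∀ {i j k} → i ≢ j → coxM ∣ A i j * A j i ∣ ≡ just k →
    Rank2 ∣ A i j ∣ ∣ A j i ∣ k
  rank2 {i} {j} {k} i≢j p = classify ∣ A i j ∣ ∣ A j i ∣ k (zeros i j) (zeros j i)
    (≡.trans (cong coxM (≡.sym (ℤ.∣i*j∣≡∣i∣*∣j∣ (A i j) (A j i)))) p)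
    where
    zeros : ∀ i j → ∣ A i j ∣ ≡ 0 → ∣ A j i ∣ ≡ 0
    zeros i j q = cong ∣_∣ (proj₂ (proj₂ gcm) i j (ℤ.∣i∣≡0⇒i≡0 q))

  private
    invol′ : ∀ (x P E : ℤ) → (x - P * E) - (+ 1 * P + - P * + 2) * E ≡ x
    invol′ = solve-∀
    as-comb : ∀ (x P E : ℤ) → x - P * E ≡ + 1 * x + - P * E
    as-comb = solve-∀

  pair-sRefl : ∀ h i μ → pair A h (sRefl A i μ) ≡ + 1 * pair A h μ + - pair A i μ * A h i
  pair-sRefl h i μ = ≡.trans
    (pair-cong A h (λ j → as-comb (μ j) (pair A i μ) (e i j)))
    (≡.trans (pair-comb A h (+ 1) μ (- pair A i μ) (e i))
      (cong (λ z → + 1 * pair A h μ + - pair A i μ * z) (pair-e A h i)))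

  sRefl-involutive : ∀ i μ → sRefl A i (sRefl A i μ) ≗ μ
  sRefl-involutive i μ j = ≡.trans
    (cong (λ c → sRefl A i μ j - c * e i j)
      (≡.trans (pair-sRefl i i μ) (cong (λ z → + 1 * pair A i μ + - pair A i μ * z) (proj₁ gcm i))))
    (invol′ (μ j) (pair A i μ) (e i j))

  -- The displacement (s_i s_j)^k μ − μ is a combination of α_i and α_j whose
  -- coefficients are linear in x = ⟨α_i^∨, μ⟩ and y = ⟨α_j^∨, μ⟩;
  -- (p , p′ , q , q′) stands for (p x + p′ y) α_i + (q x + q′ y) α_j.
  Displacement : Set
  Displacement = ℤ × ℤ × ℤ × ℤ

  -- s_j acts first and changes only the α_j coefficient, to `r` and `r′`; s_i then changes the α_i
  -- coefficient using these new values. The two constants - 1 come from the pairings of μ itself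
  -- with the coroots.
  rotate : ℤ → ℤ → Displacement → Displacement
  rotate a b (p , p′ , q , q′) = - p - a * r - + 1 , - p′ - a * r′ , r , r′
    where
    r  = - q - b * p
    r′ = - q′ - b * p′ - + 1

  rotations : ℤ → ℤ → ℕ → Displacement
  rotations a b zero    = + 0 , + 0 , + 0 , + 0
  rotations a b (suc k) = rotate a b (rotations a b k)

  module _ (i j : Fin n) (μ : Lattice n) where
    private
      x y : ℤ
      x = pair A i μ
      y = pair A j μ

    displace : Displacement → Lattice n
    displace (p , p′ , q , q′) h = + 1 * μ h + + 1 * ((p * x + p′ * y) * e i h + (q * x + q′ * y) * e j h)

    pair-displace : ∀ h p p′ q q′ → pair A h (displace (p , p′ , q , q′)) ≡
      + 1 * pair A h μ + + 1 * ((p * x + p′ * y) * A h i + (q * x + q′ * y) * A h j)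
    pair-displace h p p′ q q′ = ≡.trans
      (pair-comb A h (+ 1) μ (+ 1) (comb (p * x + p′ * y) (e i) (q * x + q′ * y) (e j)))
      (cong (λ z → + 1 * pair A h μ + + 1 * z)
        (≡.trans (pair-comb A h (p * x + p′ * y) (e i) (q * x + q′ * y) (e j))
          (cong₂ (λ s t → (p * x + p′ * y) * s + (q * x + q′ * y) * t) (pair-e A h i) (pair-e A h j))))

    private
      step-j : ∀ (m x y p p′ q q′ b E F : ℤ) →
        (+ 1 * m + + 1 * ((p * x + p′ * y) * E + (q * x + q′ * y) * F))
          - (+ 1 * y + + 1 * ((p * x + p′ * y) * b + (q * x + q′ * y) * + 2)) * F
        ≡ + 1 * m + + 1 * ((p * x + p′ * y) * E + ((- q - b * p) * x + (- q′ - b * p′ - + 1) * y) * F)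
      step-j = solve-∀
      step-i : ∀ (m x y p p′ q q′ a E F : ℤ) →
        (+ 1 * m + + 1 * ((p * x + p′ * y) * E + (q * x + q′ * y) * F))
          - (+ 1 * x + + 1 * ((p * x + p′ * y) * + 2 + (q * x + q′ * y) * a)) * E
        ≡ + 1 * m + + 1 * (((- p - a * q - + 1) * x + (- p′ - a * q′) * y) * E + (q * x + q′ * y) * F)
      step-i = solve-∀

    rotate-displace : ∀ d → sRefl A i (sRefl A j (displace d)) ≗ displace (rotate (A i j) (A j i) d)
    rotate-displace (p , p′ , q , q′) h = ≡.trans (sRefl-cong A i half h)
      (≡.trans
        (cong (λ c → displace mid h - c * e i h)
          (≡.trans (pair-displace i p p′ r r′)
            (cong (λ z → + 1 * x + + 1 * ((p * x + p′ * y) * z + (r * x + r′ * y) * A i j)) (proj₁ gcm i))))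
        (step-i (μ h) x y p p′ r r′ (A i j) (e i h) (e j h)))
      where
      r r′ : ℤ
      r  = - q - A j i * p
      r′ = - q′ - A j i * p′ - + 1
      mid : Displacement
      mid = p , p′ , r , r′
      half : sRefl A j (displace (p , p′ , q , q′)) ≗ displace mid
      half g = ≡.trans
        (cong (λ c → displace (p , p′ , q , q′) g - c * e j g)
          (≡.trans (pair-displace j p p′ q q′)
            (cong (λ z → + 1 * y + + 1 * ((p * x + p′ * y) * A j i + (q * x + q′ * y) * z)) (proj₁ gcm j))))
        (step-j (μ g) x y p p′ q q′ (A j i) (e i g) (e j g))

    private
      displace-0 : ∀ (m x y E F : ℤ) →
        + 1 * m + + 1 * ((+ 0 * x + + 0 * y) * E + (+ 0 * x + + 0 * y) * F) ≡ m
      displace-0 = solve-∀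

    act-rotations : ∀ k → act A (concat (replicate k (i ∷ j ∷ []))) μ
      ≗ displace (rotations (A i j) (A j i) k)
    act-rotations zero    h = ≡.sym (displace-0 (μ h) x y (e i h) (e j h))
    act-rotations (suc k) h = ≡.trans
      (sRefl-cong A i (sRefl-cong A j (act-rotations k)) h)
      (rotate-displace (rotations (A i j) (A j i) k) h)

    -- It is the universal coefficients that vanish, not just the displacement of one μ, so each
    -- type is a closed computation.
    rotations-trivial : ∀ {a b k} → Rank2 a b k → rotations (- (+ a)) (- (+ b)) k ≡ (+ 0 , + 0 , + 0 , + 0)
    rotations-trivial A₁×A₁ = refl
    rotations-trivial A₂    = refl
    rotations-trivial B₂    = refl
    rotations-trivial C₂    = refl
    rotations-trivial G₂    = refl
    rotations-trivial G₂′   = refl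

    act-braid : ∀ {k} → i ≢ j → coxM ∣ A i j * A j i ∣ ≡ just k →
      act A (concat (replicate k (i ∷ j ∷ []))) μ ≗ μ
    act-braid {k} i≢j p h = ≡.trans (act-rotations k h)
      (≡.trans (cong (λ d → displace d h)
          (≡.trans (cong₂ (λ a b → rotations a b k) (offdiag i j i≢j) (offdiag j i (λ q → i≢j (≡.sym q))))
            (rotations-trivial (rank2 i≢j p))))
        (displace-0 (μ h) x y (e i h) (e j h)))

  act-relator : ∀ {r} → Relator A r → ∀ μ → act A r μ ≗ μ
  act-relator (square i)            μ = sRefl-involutive i μ
  act-relator (braid i j k i≢j p) μ = act-braid i j μ i≢j p

  act-~ : ∀ {x y} → Equiv A x y → ∀ μ → act A x μ ≗ act A y μ
  act-~ (rel u v {r} R) μ h = ≡.trans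
    (cong (λ f → f h) (≡.trans (act-++ A u (r ++ v) μ) (cong (act A u) (act-++ A r v μ))))
    (≡.trans (act-cong A u (act-relator R (act A v μ)) h)
      (cong (λ f → f h) (≡.sym (act-++ A u v μ))))
  act-~ refl        μ h = refl
  act-~ (sym p)     μ h = ≡.sym (act-~ p μ h)
  act-~ (trans p q) μ h = ≡.trans (act-~ p μ h) (act-~ q μ h)

  private
    neg-comb : ∀ (x : ℤ) → x - + 2 * x ≡ - (+ 1) * x + + 0 * x
    neg-comb = solve-∀
    comb-neg : ∀ (x : ℤ) → - (+ 1) * x + + 0 * x ≡ - x
    comb-neg = solve-∀

  act-snoc : ∀ w i → act A (w ++ i ∷ []) (e i) ≗ negL (act A w (e i))
  act-snoc w i h = ≡.trans (cong (λ f → f h) (act-++ A w (i ∷ []) (e i)))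
    (≡.trans (act-cong A w negated h)
      (≡.trans (act-comb A w (- (+ 1)) (e i) (+ 0) (e i) h) (comb-neg (act A w (e i) h))))
    where
    negated : sRefl A i (e i) ≗ comb (- (+ 1)) (e i) (+ 0) (e i)
    negated g = ≡.trans
      (cong (λ c → e i g - c * e i g) (≡.trans (pair-e A i i) (proj₁ gcm i)))
      (neg-comb (e i g))

  act-injective : ∀ w {μ ν} → act A w μ ≗ act A w ν → μ ≗ ν
  act-injective []      p = p
  act-injective (i ∷ w) {μ} {ν} p = act-injective w λ h → ≡.trans
    (≡.sym (sRefl-involutive i (act A w μ) h))
    (≡.trans (sRefl-cong A i p h) (sRefl-involutive i (act A w ν) h))

  act-0 : ∀ w → act A w (λ _ → + 0) ≗ (λ _ → + 0)
  act-0 w = act-comb A w (+ 0) (λ _ → + 0) (+ 0) (λ _ → + 0)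

  -- This keeps the two signs apart: a root that is both nonnegative and nonpositive would be 0.
  act-e≢0 : ∀ w i → act A w (e i) ≗ (λ _ → + 0) → ⊥
  act-e≢0 w i p with ≡.trans (≡.sym (e-diag i)) (act-injective w (λ h → ≡.trans (p h) (≡.sym (act-0 w h))) i)
    where
    e-diag : ∀ {n} (i : Fin n) → e i i ≡ + 1
    e-diag zero    = refl
    e-diag (suc i) = e-diag i
  ... | ()

-- The sign of a root and shorter words

alternating : ∀ {X : Set} → X → X → ℕ → List X
alternating x y zero    = []
alternating x y (suc k) = x ∷ alternating y x k

letterAt : ∀ {X : Set} → X → X → ℕ → X
letterAt x y zero    = x
letterAt x y (suc k) = letterAt y x k

alternating-snoc : ∀ {X : Set} (x y : X) k →
  alternating x y (suc k) ≡ alternating x y k ++ letterAt x y k ∷ []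
alternating-snoc x y zero    = refl
alternating-snoc x y (suc k) = cong (x ∷_) (alternating-snoc y x k)

length-alternating : ∀ {X : Set} (x y : X) k → length (alternating x y k) ≡ k
length-alternating x y zero    = refl
length-alternating x y (suc k) = cong suc (length-alternating y x k)

-- Coordinates with respect to α_x, α_y of the root obtained by applying
-- s_x s_y s_x ⋯ (k factors) to the simple root at the next letter, where a = - A x y, b = - A y x.
coords : ℤ → ℤ → ℕ → ℤ × ℤ
coords a b zero    = + 1 , + 0
coords a b (suc k) = let p , q = coords b a k in a * p - q , p

NonnegPair : ℤ × ℤ → Set
NonnegPair (p , q) = + 0 ℤ.≤ p × + 0 ℤ.≤ q

nonnegPair? : ∀ c → Dec (NonnegPair c)
nonnegPair? (p , q) = (+ 0 ℤ.≤? p) ×-dec (+ 0 ℤ.≤? q)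

coords-finite : ∀ {a b m} → Rank2 a b m → ∀ {k} → k ℕ.< m → NonnegPair (coords (+ a) (+ b) k)
coords-finite A₁×A₁ = from-yes (ℕ.allUpTo? (λ k → nonnegPair? (coords (+ 0) (+ 0) k)) 2)
coords-finite A₂    = from-yes (ℕ.allUpTo? (λ k → nonnegPair? (coords (+ 1) (+ 1) k)) 3)
coords-finite B₂    = from-yes (ℕ.allUpTo? (λ k → nonnegPair? (coords (+ 1) (+ 2) k)) 4)
coords-finite C₂    = from-yes (ℕ.allUpTo? (λ k → nonnegPair? (coords (+ 2) (+ 1) k)) 4)
coords-finite G₂    = from-yes (ℕ.allUpTo? (λ k → nonnegPair? (coords (+ 1) (+ 3) k)) 6)
coords-finite G₂′   = from-yes (ℕ.allUpTo? (λ k → nonnegPair? (coords (+ 3) (+ 1) k)) 6)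

-- The bound a q ≤ 2 p says that s_x has increased the coordinate of α_x; ab ≥ 4 propagates it.
coords-infinite : ∀ a b → 4 ℕ.≤ a ℕ.* b → ∀ k →
  ∃ λ p → ∃ λ q → coords (+ a) (+ b) k ≡ (+ p , + q) × a ℕ.* q ℕ.≤ 2 ℕ.* p
coords-infinite a b ab≥4 zero    = 1 , 0 , refl , ℕ.≤-trans (ℕ.≤-reflexive (ℕ.*-zeroʳ a)) ℕ.z≤n
coords-infinite a b ab≥4 (suc k) with coords-infinite b a (subst (4 ℕ.≤_) (ℕ.*-comm a b) ab≥4) k
... | p , q , eq , bq≤2p = a ℕ.* p ℕ.∸ q , p , eq′ , bound
  where
  2q≤ap : 2 ℕ.* q ℕ.≤ a ℕ.* p
  2q≤ap = ℕ.*-cancelˡ-≤ 2 (begin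
    2 ℕ.* (2 ℕ.* q)   ≡⟨ ≡.sym (ℕ.*-assoc 2 2 q) ⟩
    4 ℕ.* q           ≤⟨ ℕ.*-monoˡ-≤ q ab≥4 ⟩
    (a ℕ.* b) ℕ.* q   ≡⟨ ℕ.*-assoc a b q ⟩
    a ℕ.* (b ℕ.* q)   ≤⟨ ℕ.*-monoʳ-≤ a bq≤2p ⟩
    a ℕ.* (2 ℕ.* p)   ≡⟨ ≡.sym (ℕ.*-assoc a 2 p) ⟩
    (a ℕ.* 2) ℕ.* p   ≡⟨ cong (ℕ._* p) (ℕ.*-comm a 2) ⟩
    (2 ℕ.* a) ℕ.* p   ≡⟨ ℕ.*-assoc 2 a p ⟩
    2 ℕ.* (a ℕ.* p)   ∎)
    where open ℕ.≤-Reasoning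
  q≤ap : q ℕ.≤ a ℕ.* p
  q≤ap = ℕ.≤-trans (ℕ.m≤m+n q _) 2q≤ap
  eq′ : coords (+ a) (+ b) (suc k) ≡ (+ (a ℕ.* p ℕ.∸ q) , + p)
  eq′ rewrite eq = cong (_, + p) (≡.trans (cong (_- + q) (≡.sym (ℤ.pos-* a p)))
    (≡.trans (ℤ.m-n≡m⊖n (a ℕ.* p) q) (ℤ.⊖-≥ q≤ap)))
  r : ℕ
  r = a ℕ.* p ℕ.∸ q
  r+q : r ℕ.+ q ≡ a ℕ.* p
  r+q = ℕ.m∸n+n≡m q≤ap
  q≤r : q ℕ.≤ r
  q≤r = ℕ.+-cancelʳ-≤ q q r (subst₂ ℕ._≤_ (cong (q ℕ.+_) (ℕ.+-identityʳ q)) (≡.sym r+q) 2q≤ap)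
  bound : a ℕ.* p ℕ.≤ 2 ℕ.* r
  bound = subst₂ ℕ._≤_ r+q (cong (r ℕ.+_) (≡.sym (ℕ.+-identityʳ r))) (ℕ.+-monoʳ-≤ r q≤r)

module Positivity {n : ℕ} (A : Matrix n) (gcm : IsGCM A) where
  open GCM A gcm

  order : Fin n → Fin n → Maybe ℕ
  order x y = coxM ∣ A x y * A y x ∣

  order-sym : ∀ x y → order x y ≡ order y x
  order-sym x y = cong (λ c → coxM ∣ c ∣) (ℤ.*-comm (A x y) (A y x))

  order-cases : ∀ c {k} → coxM c ≡ just k → k ≡ 2 ⊎ k ≡ 3 ⊎ k ≡ 4 ⊎ k ≡ 6
  order-cases 0 refl = inj₁ refl
  order-cases 1 refl = inj₂ (inj₁ refl)
  order-cases 2 refl = inj₂ (inj₂ (inj₁ refl))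
  order-cases 3 refl = inj₂ (inj₂ (inj₂ refl))

  relator-halves : ∀ {c k} → coxM c ≡ just k → ∀ (x y : Fin n) →
    concat (replicate k (x ∷ y ∷ [])) ≡ alternating x y k ++ reverse (alternating y x k)
  relator-halves {c} p x y with order-cases c p
  ... | inj₁ refl               = refl
  ... | inj₂ (inj₁ refl)        = refl
  ... | inj₂ (inj₂ (inj₁ refl)) = refl
  ... | inj₂ (inj₂ (inj₂ refl)) = refl

  braid-~ : ∀ {x y k} → x ≢ y → order x y ≡ just k →
    Equiv A (alternating x y k) (alternating y x k)
  braid-~ {x} {y} {k} x≢y p = quotient⇒~ A (alternating x y k) (alternating y x k)
    (subst (λ r → Equiv A r []) (≡.trans (++-identityʳ _) (relator-halves p x y))
      (rel [] [] (braid x y k x≢y p)))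

  -- Vacuous when `order x y` is `nothing`, that is when s_x s_y has no relation.
  Short : Fin n → Fin n → ℕ → Set
  Short x y k = ∀ m → order x y ≡ just m → k ℕ.< m

  coords-nonneg : ∀ {x y k} → x ≢ y → Short x y k → NonnegPair (coords (- A x y) (- A y x) k)
  coords-nonneg {x} {y} {k} x≢y short = subst₂ (λ a b → NonnegPair (coords a b k))
    (≡.sym (neg-offdiag x y x≢y)) (≡.sym (neg-offdiag y x (λ q → x≢y (≡.sym q)))) (go (order x y) refl)
    where
    neg-offdiag : ∀ x y → x ≢ y → - A x y ≡ + ∣ A x y ∣
    neg-offdiag x y x≢y = ≡.trans (cong -_ (offdiag x y x≢y)) (ℤ.neg-involutive _)
    go : ∀ o → order x y ≡ o → NonnegPair (coords (+ ∣ A x y ∣) (+ ∣ A y x ∣) k)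
    go (just m) p = coords-finite (rank2 x≢y p) (short m p)
    go nothing  p with coords-infinite ∣ A x y ∣ ∣ A y x ∣
      (subst (4 ℕ.≤_) (ℤ.∣i*j∣≡∣i∣*∣j∣ (A x y) (A y x)) (coxM-nothing _ p)) k
    ... | _ , _ , eq , _ = subst NonnegPair (≡.sym eq) (ℤ.+≤+ ℕ.z≤n , ℤ.+≤+ ℕ.z≤n)

  private
    base : ∀ (E F : ℤ) → E ≡ + 1 * E + + 0 * F
    base = solve-∀
    next : ∀ (p q a E F : ℤ) → (p * F + q * E) - (p * a + q * + 2) * E ≡ (- a * p - q) * E + p * F
    next = solve-∀

  act-alternating : ∀ x y k → let p , q = coords (- A x y) (- A y x) k in
    act A (alternating x y k) (e (letterAt x y k)) ≗ comb p (e x) q (e y)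
  act-alternating x y zero    h = base (e x h) (e y h)
  act-alternating x y (suc k) h = let p , q = coords (- A y x) (- A x y) k in ≡.trans
    (sRefl-cong A x (act-alternating y x k) h)
    (≡.trans
      (cong (λ c → comb p (e y) q (e x) h - c * e x h)
        (≡.trans (pair-comb A x p (e y) q (e x))
          (cong₂ (λ s t → p * s + q * t) (pair-e A x y) (≡.trans (pair-e A x x) (proj₁ gcm x)))))
      (next p q (A x y) (e x h) (e y h)))

  Shortens : Word n → Fin n → Set
  Shortens w i = ∃ λ x → length x ℕ.< length w × Equiv A x (w ++ i ∷ [])

  -- The word `w` need not be reduced, and lengths of words replace ℓ; the first alternative
  -- therefore says nothing about shortening.
  Sign : Word n → Fin n → Set
  Sign w i = Nonneg (act A w (e i)) ⊎ (Shortens w i × Nonpos (act A w (e i)))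

  module _ (w : Word n) (IH : ∀ y → length y ℕ.< length w → ∀ i → Sign y i) where

    sign-transfer : ∀ y i → length y ℕ.< length w → Equiv A y w → Sign w i
    sign-transfer y i lt y~w with IH y lt i
    ... | inj₁ pos = inj₁ λ j → subst (+ 0 ℤ.≤_) (act-~ y~w (e i) j) (pos j)
    ... | inj₂ ((x , lt′ , x~yi) , neg) = inj₂
      ((x , ℕ.<-trans lt′ lt , trans x~yi (~-++ʳ A (i ∷ []) y~w)) ,
       λ j → subst (ℤ._≤ + 0) (act-~ y~w (e i) j) (neg j))

    -- A shorter word `z` of w s_i satisfies z α_i = - w α_i. If z α_i is positive, `z` is the
    -- required witness; otherwise z s_i, which is w, has a word shorter than `z`, and the sign
    -- comes from that word.
    sign-shortens : ∀ i → Shortens w i → Sign w i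
    sign-shortens i (z , lt , z~wi) with IH z lt i
    ... | inj₁ pos = inj₂ ((z , lt , z~wi) , λ j → subst (ℤ._≤ + 0)
      (≡.trans (cong -_ (≡.trans (act-~ z~wi (e i) j) (act-snoc w i j))) (ℤ.neg-involutive _))
      (ℤ.neg-mono-≤ (pos j)))
    ... | inj₂ ((x , lt′ , x~zi) , _) = sign-transfer x i (ℕ.<-trans lt′ lt)
      (trans x~zi (sym (~-snoc-swap A z w i z~wi)))

    -- Writing w = v · d with d alternating in x, y and as long as possible makes v minimal in its
    -- coset of ⟨s_x , s_y⟩.
    peel : ∀ N v x y k i → length v ℕ.≤ N → x ≢ y → letterAt x y (suc k) ≡ i → Short x y (suc k) →
      Equiv A w (v ++ alternating x y (suc k)) → length v ℕ.+ suc k ℕ.≤ length w → Sign w i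
    peel N v x y k i v≤N x≢y last short w~ len = cases (IH v v<w x) (IH v v<w y)
      where
      v<w : length v ℕ.< length w
      v<w = ℕ.≤-trans (ℕ.≤-trans (ℕ.s≤s (ℕ.m≤m+n (length v) k)) (ℕ.≤-reflexive (≡.sym (ℕ.+-suc _ k)))) len
      len-++ : ∀ z x y k → length (z ++ alternating x y k) ≡ length z ℕ.+ k
      len-++ z x y k = ≡.trans (length-++ z) (cong (length z ℕ.+_) (length-alternating x y k))

      -- w α_i = p · v α_x + q · v α_y, with p, q ≥ 0 because the alternating part is shorter than
      -- the braid length.
      positive : Nonneg (act A v (e x)) → Nonneg (act A v (e y)) → Nonneg (act A w (e i))
      positive px py j = subst (+ 0 ℤ.≤_)
        (≡.sym (≡.trans (act-~ w~ (e i) j)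
          (≡.trans (cong (λ f → f j) (act-++ A v _ (e i)))
            (≡.trans
              (act-cong A v (λ h → ≡.trans
                (cong (λ l → act A (alternating x y (suc k)) (e l) h) (≡.sym last))
                (act-alternating x y (suc k) h)) j)
              (act-comb A v p (e x) q (e y) j)))))
        (ℤ.+-mono-≤ (mul-nonneg (proj₁ pq≥0) (px j)) (mul-nonneg (proj₂ pq≥0) (py j)))
        where
        p q : ℤ
        p = proj₁ (coords (- A x y) (- A y x) (suc k))
        q = proj₂ (coords (- A x y) (- A y x) (suc k))
        pq≥0 = coords-nonneg x≢y short
        mul-nonneg : ∀ {a b} → + 0 ℤ.≤ a → + 0 ℤ.≤ b → + 0 ℤ.≤ a * b
        mul-nonneg {+ a} {+ b} _ _ = subst (+ 0 ℤ.≤_) (ℤ.pos-* a b) (ℤ.+≤+ ℕ.z≤n)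

      -- A shorter word of v s_x uses up the first alternating letter, so `w` itself has a shorter
      -- word.
      absorb : Shortens v x → Sign w i
      absorb (z , lt , z~vx) = sign-transfer (z ++ alternating y x k) i
        (ℕ.≤-trans (ℕ.≤-trans (ℕ.s≤s (ℕ.≤-reflexive (len-++ z y x k)))
          (ℕ.≤-trans (ℕ.+-monoˡ-≤ k lt) (ℕ.+-monoʳ-≤ (length v) (ℕ.n≤1+n k)))) len)
        (sym (trans w~ (trans (≡⇒~ A (≡.sym (++-assoc v (x ∷ []) _)))
          (~-++ʳ A _ (sym z~vx)))))

      -- The letter `i` completes the alternating word to braid length. With v ~ z y, the braid
      -- relation turns w s_i into z y y x ⋯, where the two y cancel.
      close : order x y ≡ just (suc (suc k)) → Shortens v y → Shortens w i
      close ord (z , lt , z~vy) = z ++ alternating x y (suc k) ,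
        ℕ.≤-trans (ℕ.≤-trans (ℕ.s≤s (ℕ.≤-reflexive (len-++ z x y (suc k)))) (ℕ.+-monoˡ-≤ (suc k) lt)) len ,
        trans (sym (cancel-square A z y _))
          (trans (~-++ˡ A z (~-++ˡ A (y ∷ []) (sym (braid-~ x≢y ord))))
            (trans (≡⇒~ A (≡.sym (++-assoc z (y ∷ []) _)))
              (trans (~-++ʳ A _ (sym (~-snoc-swap A z v y z~vy)))
                (trans (≡⇒~ A (≡.trans
                         (cong (v ++_) (≡.trans (alternating-snoc x y (suc k))
                           (cong (λ l → alternating x y (suc k) ++ l ∷ []) last)))
                         (≡.sym (++-assoc v _ (i ∷ [])))))
                  (~-++ʳ A (i ∷ []) (sym w~))))))

      -- The final y of v ~ z y moves into the alternating part, which stays below braid length; the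
      -- bound `N` on the length of `v` decreases.
      extend : ∀ N → length v ℕ.≤ N → Short y x (suc (suc k)) → Shortens v y → Sign w i
      extend zero    v≤N short′ (z , lt , z~vy) = contradiction (ℕ.≤-trans lt v≤N) λ ()
      extend (suc N) v≤N short′ (z , lt , z~vy) =
        peel N z y x (suc k) i (ℕ.≤-pred (ℕ.≤-trans lt v≤N)) (λ q → x≢y (≡.sym q)) last short′
          (trans w~ (trans (~-++ʳ A _ (~-snoc-swap A z v y z~vy)) (≡⇒~ A (++-assoc z (y ∷ []) _))))
          (ℕ.≤-trans (ℕ.≤-reflexive (ℕ.+-suc (length z) (suc k)))
            (ℕ.≤-trans (ℕ.+-monoˡ-≤ (suc k) lt) len))

      cases : Sign v x → Sign v y → Sign w i
      cases (inj₂ (s , _)) _              = absorb s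
      cases (inj₁ px)      (inj₁ py)      = inj₁ (positive px py)
      cases (inj₁ px)      (inj₂ (s , _)) = go (order x y) refl
        where
        go : ∀ o → order x y ≡ o → Sign w i
        go nothing  p = extend N v≤N (λ m q → contradiction (≡.trans (≡.sym p) (≡.trans (order-sym x y) q)) λ ()) s
        go (just m) p with suc (suc k) ℕ.≟ m
        ... | yes refl = sign-shortens i (close p s)
        ... | no  ≢m   = extend N v≤N (λ m′ q → subst (suc (suc k) ℕ.<_)
              (just-injective (≡.trans (≡.sym p) (≡.trans (order-sym x y) q))) (ℕ.≤∧≢⇒< (short m p) ≢m)) s

  order>1 : ∀ {x y} → Short x y 1
  order>1 m p with order-cases _ p
  ... | inj₁ refl               = ℕ.s≤s (ℕ.s≤s ℕ.z≤n)
  ... | inj₂ (inj₁ refl)        = ℕ.s≤s (ℕ.s≤s ℕ.z≤n)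
  ... | inj₂ (inj₂ (inj₁ refl)) = ℕ.s≤s (ℕ.s≤s ℕ.z≤n)
  ... | inj₂ (inj₂ (inj₂ refl)) = ℕ.s≤s (ℕ.s≤s ℕ.z≤n)

  sign-bounded : ∀ N w → length w ℕ.< N → ∀ i → Sign w i
  sign-bounded (suc N) w lt i with initLast w
  ... | [] = inj₁ nonneg
    where
    nonneg : Nonneg (e i)
    nonneg j with i ≟F j
    ... | yes _ = ℤ.+≤+ ℕ.z≤n
    ... | no  _ = ℤ.+≤+ ℕ.z≤n
  ... | w′ ∷ʳ′ t with t ≟F i
  ...   | yes refl = sign-shortens (w′ ++ t ∷ []) IH i
            (w′ , ℕ.≤-reflexive (≡.sym (≡.trans (length-++ w′) (ℕ.+-comm _ 1))) ,
             sym (trans (≡⇒~ A (++-assoc w′ _ _)) (trans (cancel-square A w′ i []) (≡⇒~ A (++-identityʳ w′)))))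
    where
    IH : ∀ y → length y ℕ.< length (w′ ++ t ∷ []) → ∀ i → Sign y i
    IH y y<w = sign-bounded N y (ℕ.≤-trans y<w (ℕ.≤-pred lt))
  -- The alternating part starts as the single letter `t`, and the next letter of the alternation is
  -- `i`.
  ...   | no t≢i = peel (w′ ++ t ∷ []) IH (length w′) w′ t i 0 i ℕ.≤-refl t≢i refl order>1
            refl (ℕ.≤-reflexive (≡.sym (length-++ w′)))
    where
    IH : ∀ y → length y ℕ.< length (w′ ++ t ∷ []) → ∀ i → Sign y i
    IH y y<w = sign-bounded N y (ℕ.≤-trans y<w (ℕ.≤-pred lt))

  sign : ∀ w i → Sign w i
  sign w = sign-bounded (suc (length w)) w ℕ.≤-refl

-- The word problem, directions of steps and labels

module WordProblem {n : ℕ} (A : Matrix n) (gcm : IsGCM A) where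
  open GCM A gcm
  open Positivity A gcm

  ¬nonneg∧nonpos : ∀ w i → Nonneg (act A w (e i)) → ¬ Nonpos (act A w (e i))
  ¬nonneg∧nonpos w i p q = act-e≢0 w i (λ j → ℤ.≤-antisym (q j) (p j))

  nonpos⇒shortens : ∀ w i → Nonpos (act A w (e i)) → Shortens w i
  nonpos⇒shortens w i q with sign w i
  ... | inj₁ p       = contradiction q (¬nonneg∧nonpos w i p)
  ... | inj₂ (s , _) = s

  act-snoc-nonneg : ∀ w i → Nonneg (act A (w ++ i ∷ []) (e i)) → Nonpos (act A w (e i))
  act-snoc-nonneg w i p j = subst (ℤ._≤ + 0)
    (≡.trans (cong -_ (act-snoc w i j)) (ℤ.neg-involutive _)) (ℤ.neg-mono-≤ (p j))

  act-snoc-nonpos : ∀ w i → Nonneg (act A w (e i)) → Nonpos (act A (w ++ i ∷ []) (e i))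
  act-snoc-nonpos w i p j = subst (ℤ._≤ + 0) (≡.sym (act-snoc w i j)) (ℤ.neg-mono-≤ (p j))

  Dominant : Word n → Set
  Dominant w = ∀ i → Nonneg (act A w (e i))

  dominant-~ : ∀ {x y} → Equiv A x y → Dominant x → Dominant y
  dominant-~ x~y p i j = subst (+ 0 ℤ.≤_) (act-~ x~y (e i) j) (p i j)

  -- For w = v s_t, w α_t ≥ 0 forces v α_t ≤ 0. Hence v s_t, which is `w`, has a word shorter than
  -- `v`, and the descent stops only at the empty word.
  dominant⇒trivial : ∀ N w → length w ℕ.< N → Dominant w → Equiv A w []
  dominant⇒trivial (suc N) w lt p with initLast w
  ... | []       = refl
  ... | v ∷ʳ′ t with nonpos⇒shortens v t (act-snoc-nonneg v t (p t))
  ...   | x , x<v , x~w = trans (sym x~w) (dominant⇒trivial N x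
            (ℕ.≤-trans x<v (ℕ.≤-trans (ℕ.n≤1+n _)
              (ℕ.≤-trans (ℕ.≤-reflexive (≡.sym (≡.trans (length-++ v) (ℕ.+-comm _ 1)))) (ℕ.≤-pred lt))))
            (dominant-~ (sym x~w) p))

  -- Dominance is a finite check on integer coordinates, and it holds exactly for the words of the
  -- identity.
  trivial? : ∀ w → Dec (Equiv A w [])
  trivial? w = map′ (dominant⇒trivial (suc (length w)) w ℕ.≤-refl) (λ p → dominant-~ (sym p) dominant-[])
    (all? λ i → all? λ j → + 0 ℤ.≤? act A w (e i) j)
    where
    dominant-[] : Dominant []
    dominant-[] i with sign [] i
    ... | inj₁ p = p
    ... | inj₂ ((_ , () , _) , _)

  _~?_ : ∀ x y → Dec (Equiv A x y)
  x ~? y = map′ (quotient⇒~ A x y) (~⇒quotient A x y) (trivial? (x ++ reverse y))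

  -- The dichotomy is applied to a shortest word `y` of u s_i: since y α_i ≤ 0, `u` = y s_i has a
  -- word shorter than `y`.
  nonneg⇒forward : ∀ u i → Nonneg (act A u (e i)) → Forward A u i
  nonneg⇒forward u i p k k′ (_ , min) ((y , y~ui , refl) , _)
    with nonpos⇒shortens y i (λ j → subst (ℤ._≤ + 0) (act-~ (sym y~ui) (e i) j) (act-snoc-nonpos u i p j))
  ... | x , x<y , x~yi = ℕ.≤-trans (ℕ.s≤s (min x (trans x~yi (sym (~-snoc-swap A y u i y~ui))))) x<y

  -- `Forward` quantifies over all lengths, so refuting it requires that lengths exist. The
  -- refutation ends in `⊥`, for which double-negated existence, by descent, is enough.
  length-exists : ∀ w → ¬ ¬ (∃ λ k → IsLength A w k)
  length-exists w none = search (suc (length w)) w refl ℕ.≤-refl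
    where
    search : ∀ N u → Equiv A u w → length u ℕ.< N → ⊥
    search (suc N) u u~w u<N = none (length u , (u , u~w , refl) , λ x x~w →
      ℕ.≮⇒≥ λ x<u → search N x x~w (ℕ.≤-trans x<u (ℕ.≤-pred u<N)))

  nonpos⇒¬forward : ∀ u i → Nonpos (act A u (e i)) → ¬ Forward A u i
  nonpos⇒¬forward u i q fwd =
    length-exists u λ (k , len) → length-exists (u ++ i ∷ []) λ (k′ , len′) →
      absurd k k′ len len′ (fwd k k′ len len′)
    where
    absurd : ∀ k k′ → IsLength A u k → IsLength A (u ++ i ∷ []) k′ → ¬ (k ℕ.< k′)
    absurd k k′ ((y , y~u , refl) , _) (_ , min′) k<k′
      with nonpos⇒shortens y i (λ j → subst (ℤ._≤ + 0) (act-~ (sym y~u) (e i) j) (q j))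
    ... | x , x<y , x~yi = ℕ.<-irrefl refl
      (ℕ.<-≤-trans (ℕ.<-trans x<y k<k′) (min′ x (trans x~yi (~-++ʳ A (i ∷ []) y~u))))

  -- The direction of the step gives the label and u α_i the same sign, so the choice - u α_i would
  -- give u α_i both signs.
  label-root : ∀ {u i β} → IsLabel A u i β → β ≗ act A u (e i)
  label-root (inj₁ p , _) = p
  label-root {u} {i} (inj₂ p , fwd , bwd) with sign u i
  ... | inj₁ pos = contradiction
          (λ j → subst (ℤ._≤ + 0) (ℤ.neg-involutive _)
            (ℤ.neg-mono-≤ (subst (+ 0 ℤ.≤_) (p j) (fwd (nonneg⇒forward u i pos) j))))
          (¬nonneg∧nonpos u i pos)
  ... | inj₂ (_ , neg) = contradiction neg (¬nonneg∧nonpos u i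
          (λ j → subst (+ 0 ℤ.≤_) (ℤ.neg-involutive _)
            (ℤ.neg-mono-≤ (subst (ℤ._≤ + 0) (p j) (bwd (nonpos⇒¬forward u i neg) j)))))

-- Polynomials, multiplication by linear forms, divisibility

-- Coefficient functions on vectors rather than on Exp n: without function
-- extensionality, functions on Exp n need not respect pointwise equality.
Coeffs : ℕ → Set
Coeffs n = Vec ℕ n → ℤ

one : ∀ {n} → Coeffs n
one []          = + 1
one (zero  ∷ m) = one m
one (suc _ ∷ m) = + 0

combC : ∀ {n} → ℤ → Coeffs n → ℤ → Coeffs n → Coeffs n
combC a p b q m = a * p m + b * q m

-- Multiplication by the variable α_j.
shift : ∀ {n} → Fin n → Coeffs n → Coeffs n
shift zero    p (zero  ∷ m) = + 0
shift zero    p (suc k ∷ m) = p (k ∷ m)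
shift (suc j) p (k ∷ m)     = shift j (λ m′ → p (k ∷ m′)) m

-- Labels and divisors are linear forms, so this operator takes the place of a general product.
lmul : ∀ {n} → Lattice n → Coeffs n → Coeffs n
lmul {n} μ p m = sumFin n (λ j → μ j * shift j p m)

shift-cong : ∀ {n} (j : Fin n) {p q : Coeffs n} → p ≗ q → shift j p ≗ shift j q
shift-cong zero    p≗q (zero  ∷ m) = refl
shift-cong zero    p≗q (suc k ∷ m) = p≗q (k ∷ m)
shift-cong (suc j) p≗q (k ∷ m)     = shift-cong j (λ m′ → p≗q (k ∷ m′)) m

private
  comb-00 : ∀ (a b : ℤ) → + 0 ≡ a * + 0 + b * + 0
  comb-00 = solve-∀

shift-comb : ∀ {n} (j : Fin n) a p b q → shift j (combC a p b q) ≗ combC a (shift j p) b (shift j q)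
shift-comb zero    a p b q (zero  ∷ m) = comb-00 a b
shift-comb zero    a p b q (suc k ∷ m) = refl
shift-comb (suc j) a p b q (k ∷ m)     = shift-comb j a _ b _ m

shift-sum : ∀ {n} k (j : Fin n) (c : Fin k → ℤ) (f : Fin k → Coeffs n) m →
  shift j (λ m → sumFin k (λ l → c l * f l m)) m ≡ sumFin k (λ l → c l * shift j (f l) m)
shift-sum k zero c f (zero ∷ m) =
  ≡.sym (≡.trans (sumFin-cong k (λ l → ℤ.*-zeroʳ (c l))) (sumFin-0 k))
shift-sum k zero    c f (suc _ ∷ m) = refl
shift-sum k (suc j) c f (h ∷ m)     = shift-sum k j c (λ l m′ → f l (h ∷ m′)) m

shift-0 : ∀ {n} (j : Fin n) m → shift j (λ _ → + 0) m ≡ + 0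
shift-0 zero    (zero  ∷ m) = refl
shift-0 zero    (suc k ∷ m) = refl
shift-0 (suc j) (k ∷ m)     = shift-0 j m

shift-comm : ∀ {n} (i j : Fin n) p → shift i (shift j p) ≗ shift j (shift i p)
shift-comm zero    zero    p m           = refl
shift-comm zero    (suc j) p (zero  ∷ m) = ≡.sym (shift-0 j m)
shift-comm zero    (suc j) p (suc k ∷ m) = refl
shift-comm (suc i) zero    p (zero  ∷ m) = shift-0 i m
shift-comm (suc i) zero    p (suc k ∷ m) = refl
shift-comm (suc i) (suc j) p (k ∷ m)     = shift-comm i j (λ m′ → p (k ∷ m′)) m

sumFin-swap : ∀ n k (f : Fin n → Fin k → ℤ) →
  sumFin n (λ i → sumFin k (f i)) ≡ sumFin k (λ j → sumFin n (λ i → f i j))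
sumFin-swap zero    k f = ≡.sym (sumFin-0 k)
sumFin-swap (suc n) k f = ≡.trans
  (cong₂ _+_ (≡.sym (ℤ.*-identityˡ (sumFin k (f zero))))
    (≡.trans (sumFin-swap n k (λ i → f (suc i))) (≡.sym (ℤ.*-identityˡ _))))
  (≡.trans (≡.sym (sumFin-comb k (+ 1) (+ 1) (f zero) (λ j → sumFin n (λ i → f (suc i) j))))
    (sumFin-cong k (λ j → cong₂ _+_ (ℤ.*-identityˡ (f zero j)) (ℤ.*-identityˡ (sumFin n (λ i → f (suc i) j))))))

sumFin-*ˡ : ∀ n c (f : Fin n → ℤ) → c * sumFin n f ≡ sumFin n (λ i → c * f i)
sumFin-*ˡ zero    c f = ℤ.*-zeroʳ c
sumFin-*ˡ (suc n) c f = ≡.trans (ℤ.*-distribˡ-+ c _ _) (cong (λ z → c * f zero + z) (sumFin-*ˡ n c _))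

module _ {n : ℕ} where

  lmul-cong : ∀ {μ ν : Lattice n} {p q} → μ ≗ ν → p ≗ q → lmul μ p ≗ lmul ν q
  lmul-cong μ≗ν p≗q m = sumFin-cong n (λ j → cong₂ _*_ (μ≗ν j) (shift-cong j p≗q m))

  private
    distr : ∀ (u a x b y : ℤ) → u * (a * x + b * y) ≡ a * (u * x) + b * (u * y)
    distr = solve-∀
    distl : ∀ (a u b v x : ℤ) → (a * u + b * v) * x ≡ a * (u * x) + b * (v * x)
    distl = solve-∀
    exch : ∀ (a b x : ℤ) → a * (b * x) ≡ b * (a * x)
    exch = solve-∀

  lmul-comb : ∀ (μ : Lattice n) a p b q → lmul μ (combC a p b q) ≗ combC a (lmul μ p) b (lmul μ q)
  lmul-comb μ a p b q m = ≡.trans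
    (sumFin-cong n (λ j → ≡.trans (cong (μ j *_) (shift-comb j a p b q m)) (distr (μ j) a _ b _)))
    (sumFin-comb n a b _ _)

  lmul-combˡ : ∀ a (μ : Lattice n) b ν p → lmul (comb a μ b ν) p ≗ combC a (lmul μ p) b (lmul ν p)
  lmul-combˡ a μ b ν p m = ≡.trans
    (sumFin-cong n (λ j → distl a (μ j) b (ν j) (shift j p m))) (sumFin-comb n a b _ _)

  lmul-lmul : ∀ (μ ν : Lattice n) p m → lmul μ (lmul ν p) m ≡
    sumFin n (λ i → sumFin n (λ j → μ i * (ν j * shift i (shift j p) m)))
  lmul-lmul μ ν p m = sumFin-cong n λ i → ≡.trans
    (cong (μ i *_) (shift-sum n i ν (λ j → shift j p) m)) (sumFin-*ˡ n (μ i) _)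

  lmul-comm : ∀ (μ ν : Lattice n) p → lmul μ (lmul ν p) ≗ lmul ν (lmul μ p)
  lmul-comm μ ν p m = ≡.trans (lmul-lmul μ ν p m)
    (≡.trans (sumFin-swap n n _)
      (≡.trans (sumFin-cong n λ j → sumFin-cong n λ i →
          ≡.trans (exch (μ i) (ν j) _) (cong (λ z → ν j * (μ i * z)) (shift-comm i j p m)))
        (≡.sym (lmul-lmul ν μ p m))))

  lmul-0 : ∀ (μ : Lattice n) {p} → p ≗ (λ _ → + 0) → lmul μ p ≗ (λ _ → + 0)
  lmul-0 μ p≗0 m = ≡.trans (lmul-cong {μ} (λ _ → refl) p≗0 m) (lmul-comb μ (+ 0) (λ _ → + 0) (+ 0) (λ _ → + 0) m)

Bounded : ∀ {n} → ℕ → Coeffs n → Set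
Bounded D p = ∀ m j → D ℕ.< lookup m j → p m ≡ + 0

bounded-one : ∀ {n} → Bounded 0 (one {n})
bounded-one (zero  ∷ m) (suc j) lt = bounded-one m j lt
bounded-one (suc k ∷ m) j       lt = refl

bounded-comb : ∀ {n D D′} {p q : Coeffs n} a b → Bounded D p → Bounded D′ q →
  Bounded (D ℕ.⊔ D′) (combC a p b q)
bounded-comb {D = D} {D′} a b bp bq m j lt
  rewrite bp m j (ℕ.≤-<-trans (ℕ.m≤m⊔n D D′) lt) | bq m j (ℕ.≤-<-trans (ℕ.m≤n⊔m D D′) lt) =
  ≡.sym (comb-00 a b)

bounded-shift : ∀ {n D} (i : Fin n) {p} → Bounded D p → Bounded (suc D) (shift i p)
bounded-shift zero    b (zero  ∷ m) j       lt = refl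
bounded-shift zero    b (suc k ∷ m) zero    lt = b (k ∷ m) zero (ℕ.≤-pred lt)
bounded-shift zero    b (suc k ∷ m) (suc j) lt = b (k ∷ m) (suc j) (ℕ.<-trans (ℕ.n<1+n _) lt)
bounded-shift (suc i) b (k ∷ m) zero    lt = ≡.trans
  (shift-cong i (λ m′ → b (k ∷ m′) zero (ℕ.<-trans (ℕ.n<1+n _) lt)) m)
  (shift-0 i m)
bounded-shift (suc i) b (k ∷ m) (suc j) lt = bounded-shift i (λ m′ j′ → b (k ∷ m′) (suc j′)) m j lt

bounded-lmul : ∀ {n D} (μ : Lattice n) {p} → Bounded D p → Bounded (suc D) (lmul μ p)
bounded-lmul {n} μ b m j lt = ≡.trans
  (sumFin-cong n λ i → ≡.trans (cong (μ i *_) (bounded-shift i b m j lt)) (ℤ.*-zeroʳ (μ i))) (sumFin-0 n)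

-- The degree bound makes the quotient a polynomial; without it, it would only be a formal power
-- series.
record DividesC {n} (β : Lattice n) (f : Coeffs n) : Set where
  constructor divides
  field
    quotient : Coeffs n
    degree   : ℕ
    bounded  : Bounded degree quotient
    equation : f ≗ lmul β quotient

module _ {n : ℕ} {β : Lattice n} where

  dividesC-cong : ∀ {f g} → f ≗ g → DividesC β f → DividesC β g
  dividesC-cong f≗g (divides q D b p) = divides q D b λ m → ≡.trans (≡.sym (f≗g m)) (p m)

  dividesC-0 : DividesC β (λ _ → + 0)
  dividesC-0 = divides (λ _ → + 0) 0 (λ _ _ _ → refl) λ m → ≡.sym (lmul-0 β (λ _ → refl) m)

  dividesC-comb : ∀ a b {f g} → DividesC β f → DividesC β g → DividesC β (combC a f b g)
  dividesC-comb a b (divides q D bq p) (divides r D′ br p′) =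
    divides (combC a q b r) (D ℕ.⊔ D′) (bounded-comb a b bq br)
      λ m → ≡.trans (cong₂ (λ s t → a * s + b * t) (p m) (p′ m)) (≡.sym (lmul-comb β a q b r m))

  dividesC-lmul : ∀ μ {f} → DividesC β f → DividesC β (lmul μ f)
  dividesC-lmul μ (divides q D b p) = divides (lmul μ q) (suc D) (bounded-lmul μ b)
    λ m → ≡.trans (lmul-cong {μ = μ} (λ _ → refl) p m) (lmul-comm μ β q m)

-- The product over a walk, paired with a function on words

module Expansion {n : ℕ} (A : Matrix n) (gcm : IsGCM A) where
  open GCM A gcm
  open Positivity A gcm

  -- The sum over masks ε of φ(γ^ε) Ψ^ε, for the part γ of a walk starting at the alcove of p.
  expand : Word n → Word n → (Word n → ℤ) → Coeffs n
  expand p []      φ m = φ [] * one m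
  expand p (i ∷ γ) φ m = expand (p ++ i ∷ []) γ φ m
    + lmul (act A p (e i)) (expand (p ++ i ∷ []) γ (λ x → φ (i ∷ x))) m

  -- The prefix enters `expand` only through the roots p α_i, so its action is all that matters.
  SameAct : Word n → Word n → Set
  SameAct p q = ∀ μ → act A p μ ≗ act A q μ

  sameAct-snoc : ∀ {p q} i → SameAct p q → SameAct (p ++ i ∷ []) (q ++ i ∷ [])
  sameAct-snoc {p} {q} i s μ h = ≡.trans (cong (λ f → f h) (act-++ A p (i ∷ []) μ))
    (≡.trans (s (sRefl A i μ) h) (cong (λ f → f h) (≡.sym (act-++ A q (i ∷ []) μ))))

  expand-cong : ∀ {p q} γ {φ φ′} → SameAct p q → φ ≗ φ′ → expand p γ φ ≗ expand q γ φ′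
  expand-cong         []      s φ≗φ′ m = cong (_* one m) (φ≗φ′ [])
  expand-cong {p} {q} (i ∷ γ) s φ≗φ′ m = cong₂ _+_ (expand-cong γ s′ φ≗φ′ m)
    (lmul-cong (s (e i)) (expand-cong γ s′ (λ x → φ≗φ′ (i ∷ x))) m)
    where
    s′ : SameAct (p ++ i ∷ []) (q ++ i ∷ [])
    s′ = sameAct-snoc {p} {q} i s

  expand-0 : ∀ p γ {φ} → φ ≗ (λ _ → + 0) → expand p γ φ ≗ (λ _ → + 0)
  expand-0 p []      φ≗0 m = cong (_* one m) (φ≗0 [])
  expand-0 p (i ∷ γ) φ≗0 m = cong₂ _+_ (expand-0 (p ++ i ∷ []) γ φ≗0 m)
    (lmul-0 (act A p (e i)) (expand-0 (p ++ i ∷ []) γ (λ x → φ≗0 (i ∷ x))) m)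

  private
    as-combC : ∀ (x y : ℤ) → x + y ≡ + 1 * x + + 1 * y
    as-combC = solve-∀

  expand-bounded : ∀ p γ φ → ∃ λ D → Bounded D (expand p γ φ)
  expand-bounded p []      φ = 0 , λ m j lt → ≡.trans (cong (φ [] *_) (bounded-one m j lt)) (ℤ.*-zeroʳ (φ []))
  expand-bounded p (i ∷ γ) φ with expand-bounded (p ++ i ∷ []) γ φ | expand-bounded (p ++ i ∷ []) γ (λ x → φ (i ∷ x))
  ... | D , b | D′ , b′ = D ℕ.⊔ suc D′ , λ m j lt → ≡.trans (as-combC (expand (p ++ i ∷ []) γ φ m) _)
    (bounded-comb (+ 1) (+ 1) b (bounded-lmul (act A p (e i)) b′) m j lt)

  infixl 6 _⊝_
  _⊝_ : Coeffs n → Coeffs n → Coeffs n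
  f ⊝ g = combC (+ 1) f (- (+ 1)) g

  CongruentAct : Lattice n → Word n → Word n → Set
  CongruentAct β p q = ∀ μ → ∃ λ c → act A p μ ≗ comb (+ 1) (act A q μ) c β

  congruentAct-snoc : ∀ {β p q} i → CongruentAct β p q → CongruentAct β (p ++ i ∷ []) (q ++ i ∷ [])
  congruentAct-snoc {β} {p} {q} i s μ
    rewrite act-++ A p (i ∷ []) μ | act-++ A q (i ∷ []) μ = s (sRefl A i μ)

  private
    difference : ∀ (x y f g h c : ℤ) →
      + 1 * (+ 1 * x + - (+ 1) * y) + + 1 * (+ 1 * (+ 1 * f + - (+ 1) * g) + c * h)
      ≡ + 1 * (x + (+ 1 * f + c * h)) + - (+ 1) * (y + g)
    difference = solve-∀
    self : ∀ (x : ℤ) → + 0 ≡ + 1 * x + - (+ 1) * x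
    self = solve-∀

  -- Labels along the two walks agree modulo β. With pα = qα + cβ the difference at one letter is pα
  -- · P′ - qα · Q′ = qα · (P′ - Q′) + cβ · P′.
  expand-mod : ∀ {β p q} γ φ → CongruentAct β p q → DividesC β (expand p γ φ ⊝ expand q γ φ)
  expand-mod []      φ s = dividesC-cong (λ m → self (φ [] * one m)) dividesC-0
  expand-mod {β} {p} {q} (i ∷ γ) φ s with s (e i)
  ... | c , p≡ = dividesC-cong rearrange
    (dividesC-comb (+ 1) (+ 1) (expand-mod γ φ s′)
      (dividesC-comb (+ 1) c (dividesC-lmul (act A q (e i)) (expand-mod γ φ′ s′)) multiple))
    where
    φ′ : Word n → ℤ
    φ′ x = φ (i ∷ x)
    s′ : CongruentAct β (p ++ i ∷ []) (q ++ i ∷ [])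
    s′ = congruentAct-snoc {p = p} {q} i s
    P Q P′ Q′ : Coeffs n
    P  = expand (p ++ i ∷ []) γ φ
    Q  = expand (q ++ i ∷ []) γ φ
    P′ = expand (p ++ i ∷ []) γ φ′
    Q′ = expand (q ++ i ∷ []) γ φ′
    multiple : DividesC β (lmul β P′)
    multiple = divides P′ (proj₁ (expand-bounded _ γ φ′)) (proj₂ (expand-bounded _ γ φ′)) λ _ → refl
    rearrange : combC (+ 1) (P ⊝ Q) (+ 1) (combC (+ 1) (lmul (act A q (e i)) (P′ ⊝ Q′)) c (lmul β P′))
      ≗ expand p (i ∷ γ) φ ⊝ expand q (i ∷ γ) φ
    rearrange m = ≡.trans
      (cong (λ z → + 1 * (P ⊝ Q) m + + 1 * (+ 1 * z + c * lmul β P′ m))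
        (lmul-comb (act A q (e i)) (+ 1) P′ (- (+ 1)) Q′ m))
      (≡.trans (difference (P m) (Q m) (lmul (act A q (e i)) P′ m) (lmul (act A q (e i)) Q′ m) (lmul β P′ m) c)
        (cong (λ z → + 1 * (P m + z) + - (+ 1) * (Q m + lmul (act A q (e i)) Q′ m))
          (≡.sym (≡.trans (lmul-cong p≡ (λ _ → refl) m)
            (lmul-combˡ (+ 1) (act A q (e i)) c β P′ m)))))

  private
    drop-letter : ∀ (x y z : ℤ) → + 1 * (+ 1 * x + - (+ 1) * y) + + 1 * z ≡ + 1 * (x + z) + - (+ 1) * y
    drop-letter = solve-∀
    sRefl-as-comb : ∀ (x c z : ℤ) → x - c * z ≡ + 1 * x + - c * z
    sRefl-as-comb = solve-∀

  -- Modulo β = u α_i the masks using the letter i vanish, and s_β fixes every root.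
  expand-reflect : ∀ u i γ φ → DividesC (act A u (e i)) (expand u (i ∷ γ) φ ⊝ expand u γ φ)
  expand-reflect u i γ φ = dividesC-cong
    (λ m → drop-letter (expand (u ++ i ∷ []) γ φ m) (expand u γ φ m) _)
    (dividesC-comb (+ 1) (+ 1) (expand-mod γ φ congruent)
      (divides P′ (proj₁ (expand-bounded _ γ _)) (proj₂ (expand-bounded _ γ _)) λ _ → refl))
    where
    P′ : Coeffs n
    P′ = expand (u ++ i ∷ []) γ (λ x → φ (i ∷ x))
    congruent : CongruentAct (act A u (e i)) (u ++ i ∷ []) u
    congruent μ = - pair A i μ , λ h → ≡.trans (cong (λ f → f h) (act-++ A u (i ∷ []) μ))
      (≡.trans (act-cong A u (λ g → sRefl-as-comb (μ g) (pair A i μ) (e i g)) h)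
        (act-comb A u (+ 1) μ (- pair A i μ) (e i) h))

  private
    regroup-⊝ : ∀ (x y f g : ℤ) → + 1 * (+ 1 * x + - (+ 1) * y) + + 1 * (+ 1 * f + - (+ 1) * g)
      ≡ + 1 * (x + f) + - (+ 1) * (y + g)
    regroup-⊝ = solve-∀

  -- The hypothesis is needed for every `φ`, because choosing a letter `i` of `u` replaces `φ` by
  -- φ(i ⋯).
  expand-prefix-mod : ∀ {β} p u γ γ′ → (∀ φ → DividesC β (expand (p ++ u) γ φ ⊝ expand (p ++ u) γ′ φ)) →
    ∀ φ → DividesC β (expand p (u ++ γ) φ ⊝ expand p (u ++ γ′) φ)
  expand-prefix-mod {β} p []      γ γ′ H φ =
    subst (λ q → DividesC β (expand q γ φ ⊝ expand q γ′ φ)) (++-identityʳ p) (H φ)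
  expand-prefix-mod {β} p (i ∷ u) γ γ′ H φ = dividesC-cong
    (λ m → ≡.trans
      (cong (λ z → + 1 * (F φ ⊝ G φ) m + + 1 * z) (lmul-comb (act A p (e i)) (+ 1) (F φ′) (- (+ 1)) (G φ′) m))
      (regroup-⊝ (F φ m) (G φ m) (lmul (act A p (e i)) (F φ′) m) (lmul (act A p (e i)) (G φ′) m)))
    (dividesC-comb (+ 1) (+ 1) (rec φ) (dividesC-lmul (act A p (e i)) (rec φ′)))
    where
    φ′ : Word n → ℤ
    φ′ x = φ (i ∷ x)
    F G : (Word n → ℤ) → Coeffs n
    F = expand (p ++ i ∷ []) (u ++ γ)
    G = expand (p ++ i ∷ []) (u ++ γ′)
    rec : ∀ φ → DividesC β (F φ ⊝ G φ)
    rec = expand-prefix-mod (p ++ i ∷ []) u γ γ′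
      (subst (λ q → ∀ φ → DividesC β (expand q γ φ ⊝ expand q γ′ φ)) (≡.sym (++-assoc p (i ∷ []) u)) H)

  -- φ factors through the nil-Coxeter monoid (with 0 ↦ 0).
  record NilCoxeter (φ : Word n → ℤ) : Set where
    field
      square-0 : ∀ x i y → φ (x ++ i ∷ i ∷ y) ≡ + 0
      braid-≡  : ∀ x {i j k} y → i ≢ j → order i j ≡ just k →
        φ (x ++ alternating i j k ++ y) ≡ φ (x ++ alternating j i k ++ y)
  open NilCoxeter public

  nilCoxeter-∷ : ∀ {φ} i → NilCoxeter φ → NilCoxeter (λ x → φ (i ∷ x))
  nilCoxeter-∷ i N .square-0 x = N .square-0 (i ∷ x)
  nilCoxeter-∷ i N .braid-≡ x  = N .braid-≡ (i ∷ x)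

  expand-prefix : ∀ p u γ γ′ → (∀ {φ} → NilCoxeter φ → expand (p ++ u) γ φ ≗ expand (p ++ u) γ′ φ) →
    ∀ {φ} → NilCoxeter φ → expand p (u ++ γ) φ ≗ expand p (u ++ γ′) φ
  expand-prefix p []      γ γ′ H {φ} N = subst (λ q → expand q γ φ ≗ expand q γ′ φ) (++-identityʳ p) (H N)
  expand-prefix p (i ∷ u) γ γ′ H N m = cong₂ _+_ (rec N m)
    (lmul-cong {μ = act A p (e i)} (λ _ → refl) (rec (nilCoxeter-∷ i N)) m)
    where
    rec : ∀ {φ} → NilCoxeter φ → expand (p ++ i ∷ []) (u ++ γ) φ ≗ expand (p ++ i ∷ []) (u ++ γ′) φ
    rec = expand-prefix (p ++ i ∷ []) u γ γ′
      (subst (λ q → ∀ {φ} → NilCoxeter φ → expand q γ φ ≗ expand q γ′ φ) (≡.sym (++-assoc p (i ∷ []) u)) H)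

  private
    cancel : ∀ (x y : ℤ) → (x + (- (+ 1) * y + + 0 * y)) + (+ 1 * y + + 1 * + 0) ≡ x
    cancel = solve-∀
    negL-as-comb : ∀ (x : ℤ) → - x ≡ - (+ 1) * x + + 0 * x
    negL-as-comb = solve-∀

  expand-square : ∀ p i γ {φ} → NilCoxeter φ → expand p (i ∷ i ∷ γ) φ ≗ expand p γ φ
  expand-square p i γ {φ} N m = ≡.trans
    (cong₂ (λ x y → (expand pii γ φ m + x) + y) first second)
    (≡.trans (cancel (expand pii γ φ m) (lmul β Q m)) (expand-cong γ back (λ _ → refl) m))
    where
    pi pii : Word n
    pi  = p ++ i ∷ []
    pii = pi ++ i ∷ []
    β : Lattice n
    β = act A p (e i)
    Q : Coeffs n
    Q = expand pii γ (λ x → φ (i ∷ x))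
    back : SameAct pii p
    back = act-~ (trans (≡⇒~ A (++-assoc p (i ∷ []) (i ∷ [])))
      (trans (cancel-square A p i []) (≡⇒~ A (++-identityʳ p))))
    -- Choosing only the second letter contributes - β times `Q`, against + β times `Q` for the
    -- first; choosing both gives 0 by `square-0`.
    first : lmul (act A pi (e i)) Q m ≡ - (+ 1) * lmul β Q m + + 0 * lmul β Q m
    first = ≡.trans
      (lmul-cong {ν = comb (- (+ 1)) β (+ 0) β} {p = Q}
        (λ h → ≡.trans (act-snoc p i h) (negL-as-comb (β h))) (λ _ → refl) m)
      (lmul-combˡ (- (+ 1)) β (+ 0) β Q m)
    R : Coeffs n
    R = lmul (act A pi (e i)) (expand pii γ (λ x → φ (i ∷ i ∷ x)))
    second : lmul β (λ m → Q m + R m) m ≡ + 1 * lmul β Q m + + 1 * + 0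
    second = ≡.trans (lmul-cong {μ = β} (λ _ → refl) (λ m → as-combC (Q m) (R m)) m)
      (≡.trans (lmul-comb β (+ 1) Q (+ 1) R m)
        (cong (λ z → + 1 * lmul β Q m + + 1 * z)
          (lmul-0 β (lmul-0 (act A pi (e i)) (expand-0 pii γ (λ x → N .square-0 [] i x))) m)))

-- Symbolic Yang-Baxter equations in rank 2

-- A term (c , a , b , w) stands for c X^a Y^b T_w, where X, Y are the two simple roots
-- of a rank 2 system (true and false) and T_w is a product of nil-Coxeter generators.
Key : Set
Key = ℕ × ℕ × List Bool

Terms : Set
Terms = List (ℤ × Key)

LinearForm : Set
LinearForm = ℤ × ℤ

mulLinear : LinearForm → Terms → Terms
mulLinear (p , q) []                    = []
mulLinear (p , q) ((c , a , b , w) ∷ T) =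
  (c * p , suc a , b , w) ∷ (c * q , a , suc b , w) ∷ mulLinear (p , q) T

prepend : Bool → Terms → Terms
prepend h []                    = []
prepend h ((c , a , b , w) ∷ T) = (c , a , b , h ∷ w) ∷ prepend h T

negateTerms : Terms → Terms
negateTerms []            = []
negateTerms ((c , k) ∷ T) = (- c , k) ∷ negateTerms T

subtract : LinearForm → ℤ → LinearForm → LinearForm
subtract (p , q) c (p′ , q′) = p - c * p′ , q - c * q′

-- (1 + β₁ T_{h₁}) ⋯ (1 + β_k T_{h_k}) for the walk of type h₁ ⋯ h_k, where ξ, η are the
-- current images of the simple roots and a, b are the off-diagonal Cartan matrix entries.
symbolic : ℤ → ℤ → LinearForm → LinearForm → List Bool → Terms
symbolic a b ξ η []          = (+ 1 , 0 , 0 , []) ∷ []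
symbolic a b ξ η (true ∷ r)  =
  let T = symbolic a b (subtract ξ (+ 2) ξ) (subtract η a ξ) r in T ++ mulLinear ξ (prepend true T)
symbolic a b ξ η (false ∷ r) =
  let T = symbolic a b (subtract ξ b η) (subtract η (+ 2) η) r in T ++ mulLinear η (prepend false T)

_≟ᴷ_ : (k k′ : Key) → Dec (k ≡ k′)
_≟ᴷ_ = Product.≡-dec ℕ._≟_ (Product.≡-dec ℕ._≟_ (List.≡-dec Bool._≟_))

repeats : List Bool → Bool
repeats []          = false
repeats (h ∷ [])    = false
repeats (h ∷ g ∷ w) = does (h Bool.≟ g) ∨ repeats (g ∷ w)

repeats-split : ∀ h w → repeats (h ∷ w) ≡ true → ∃ λ x → ∃ λ g → ∃ λ y → h ∷ w ≡ x ++ g ∷ g ∷ y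
repeats-split h (g ∷ w) p with h Bool.≟ g
... | yes refl = [] , h , w , refl
... | no  _ with repeats-split g w p
...   | x , f , y , eq = h ∷ x , f , y , cong (h ∷_) eq

-- Words without repeats alternate, and those occurring here have at most m letters; the braid
-- relation identifies only the two of length m.
canonical : ℕ → List Bool → List Bool
canonical m w = if does (List.≡-dec Bool._≟_ w (alternating true false m)) then alternating false true m else w

insertTerm : ℤ → Key → Terms → Terms
insertTerm c k []              = (c , k) ∷ []
insertTerm c k ((c′ , k′) ∷ T) =
  if does (k ≟ᴷ k′) then (c + c′ , k′) ∷ T else (c′ , k′) ∷ insertTerm c k T

normalise : ℕ → Terms → Terms
normalise m []                    = []
normalise m ((c , a , b , w) ∷ T) =
  if repeats w then normalise m T else insertTerm c (a , b , canonical m w) (normalise m T)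

vanishes : Terms → Bool
vanishes []            = true
vanishes ((c , _) ∷ T) = does (c ℤ.≟ + 0) ∧ vanishes T

braidDifference : ℕ → ℕ → ℕ → Terms
braidDifference a b m = walk true false ++ negateTerms (walk false true)
  where
  walk : Bool → Bool → Terms
  walk g h = symbolic (- (+ a)) (- (+ b)) (+ 1 , + 0) (+ 0 , + 1) (alternating g h m)

-- The variables X and Y are formal, so each type is settled by evaluation and the result applies to
-- any pair of lattice vectors.
yang-baxter : ∀ {a b m} → Rank2 a b m → vanishes (normalise m (braidDifference a b m)) ≡ true
yang-baxter A₁×A₁ = refl
yang-baxter A₂    = refl
yang-baxter B₂    = refl
yang-baxter C₂    = refl
yang-baxter G₂    = refl
yang-baxter G₂′   = refl

module Semantics {n : ℕ} (X Y : Lattice n) where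

  power : Lattice n → ℕ → Coeffs n → Coeffs n
  power μ zero    f = f
  power μ (suc a) f = lmul μ (power μ a f)

  power-cong : ∀ μ a {f g} → f ≗ g → power μ a f ≗ power μ a g
  power-cong μ zero    p = p
  power-cong μ (suc a) p = lmul-cong {μ = μ} (λ _ → refl) (power-cong μ a p)

  power-lmul : ∀ μ a ν f → lmul ν (power μ a f) ≗ power μ a (lmul ν f)
  power-lmul μ zero    ν f m = refl
  power-lmul μ (suc a) ν f m = ≡.trans (lmul-comm ν μ (power μ a f) m)
    (lmul-cong {μ = μ} (λ _ → refl) (power-lmul μ a ν f) m)

  power-0 : ∀ μ a {f} → f ≗ (λ _ → + 0) → power μ a f ≗ (λ _ → + 0)
  power-0 μ zero    p = p
  power-0 μ (suc a) p = lmul-0 μ (power-0 μ a p)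

  monomial : (List Bool → Coeffs n) → Key → Coeffs n
  monomial g (a , b , w) = power X a (power Y b (g w))

  -- The symbol T_w is interpreted by an arbitrary polynomial `g w`, later the expansion of the rest
  -- of the walk.
  ⟦_⟧ : Terms → (List Bool → Coeffs n) → Coeffs n
  ⟦ [] ⟧          g m = + 0
  ⟦ (c , k) ∷ T ⟧ g m = c * monomial g k m + ⟦ T ⟧ g m

  monomial-cong : ∀ {g g′} → (∀ w → g w ≗ g′ w) → ∀ k → monomial g k ≗ monomial g′ k
  monomial-cong p (a , b , w) = power-cong X a (power-cong Y b (p w))

  ⟦⟧-cong : ∀ T {g g′} → (∀ w → g w ≗ g′ w) → ⟦ T ⟧ g ≗ ⟦ T ⟧ g′
  ⟦⟧-cong []            p m = refl
  ⟦⟧-cong ((c , k) ∷ T) p m =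
    cong₂ (λ x y → c * x + y) (monomial-cong p k m) (⟦⟧-cong T p m)

  ⟦⟧-++ : ∀ S T g m → ⟦ S ++ T ⟧ g m ≡ ⟦ S ⟧ g m + ⟦ T ⟧ g m
  ⟦⟧-++ []            T g m = ≡.sym (ℤ.+-identityˡ _)
  ⟦⟧-++ ((c , k) ∷ S) T g m = ≡.trans (cong (λ z → c * monomial g k m + z) (⟦⟧-++ S T g m))
    (≡.sym (ℤ.+-assoc (c * monomial g k m) _ _))

  ⟦⟧-prepend : ∀ h T g → ⟦ prepend h T ⟧ g ≗ ⟦ T ⟧ (λ w → g (h ∷ w))
  ⟦⟧-prepend h []            g m = refl
  ⟦⟧-prepend h ((c , k) ∷ T) g m = cong (λ z → c * monomial (λ w → g (h ∷ w)) k m + z) (⟦⟧-prepend h T g m)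

  private
    neg-step : ∀ (c x y : ℤ) → - c * x + - y ≡ - (c * x + y)
    neg-step = solve-∀
    mul-step : ∀ (c p q x y t : ℤ) →
      c * p * x + (c * q * y + t) ≡ c * (p * x + q * y) + + 1 * t
    mul-step = solve-∀
    term-step : ∀ (c x t : ℤ) → c * x + t ≡ c * x + + 1 * t
    term-step = solve-∀

  ⟦⟧-negate : ∀ T g m → ⟦ negateTerms T ⟧ g m ≡ - ⟦ T ⟧ g m
  ⟦⟧-negate []            g m = refl
  ⟦⟧-negate ((c , k) ∷ T) g m = ≡.trans (cong (λ z → - c * monomial g k m + z) (⟦⟧-negate T g m))
    (neg-step c (monomial g k m) _)

  ⟦⟧-mulLinear : ∀ p q T g → ⟦ mulLinear (p , q) T ⟧ g ≗ lmul (comb p X q Y) (⟦ T ⟧ g)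
  ⟦⟧-mulLinear p q []                    g m = ≡.sym (lmul-0 (comb p X q Y) (λ _ → refl) m)
  ⟦⟧-mulLinear p q ((c , k@(a , b , w)) ∷ T) g m = ≡.trans
    (cong (λ t → c * p * monomial g (suc a , b , w) m + (c * q * monomial g (a , suc b , w) m + t))
      (⟦⟧-mulLinear p q T g m))
    (≡.trans (mul-step c p q _ (monomial g (a , suc b , w) m) _)
      (≡.sym (≡.trans
        (lmul-cong {μ = comb p X q Y} (λ _ → refl) (λ m → term-step c (monomial g k m) (⟦ T ⟧ g m)) m)
        (≡.trans (lmul-comb (comb p X q Y) c (monomial g k) (+ 1) (⟦ T ⟧ g) m)
          (cong (λ z → c * z + + 1 * lmul (comb p X q Y) (⟦ T ⟧ g) m)
            (≡.trans (lmul-combˡ p X q Y (monomial g k) m)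
              (cong (λ z → p * lmul X (monomial g k) m + q * z) (power-lmul X a Y (power Y b (g w)) m))))))))

  record NilCoxeterMap (m : ℕ) (g : List Bool → Coeffs n) : Set where
    field
      repeats-0       : ∀ w → repeats w ≡ true → g w ≗ (λ _ → + 0)
      alternating-≗ : g (alternating true false m) ≗ g (alternating false true m)

  private
    merge : ∀ (c d x t : ℤ) → (c + d) * x + t ≡ c * x + (d * x + t)
    merge = solve-∀
    swap : ∀ (x y t : ℤ) → y + (x + t) ≡ x + (y + t)
    swap = solve-∀

  ⟦⟧-insert : ∀ c k T g m → ⟦ insertTerm c k T ⟧ g m ≡ c * monomial g k m + ⟦ T ⟧ g m
  ⟦⟧-insert c k []              g m = refl
  ⟦⟧-insert c k ((c′ , k′) ∷ T) g m with k ≟ᴷ k′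
  ... | yes refl = merge c c′ (monomial g k m) _
  ... | no  _    = ≡.trans (cong (λ z → c′ * monomial g k′ m + z) (⟦⟧-insert c k T g m))
                     (swap (c * monomial g k m) (c′ * monomial g k′ m) _)

  module _ {ord g} (N : NilCoxeterMap ord g) where
    open NilCoxeterMap N

    canonical-≗ : ∀ w → g (canonical ord w) ≗ g w
    canonical-≗ w m with List.≡-dec Bool._≟_ w (alternating true false ord)
    ... | yes refl = ≡.sym (alternating-≗ m)
    ... | no  _    = refl

    ⟦⟧-normalise : ∀ T → ⟦ normalise ord T ⟧ g ≗ ⟦ T ⟧ g
    ⟦⟧-normalise []                    m = refl
    ⟦⟧-normalise ((c , a , b , w) ∷ T) m with repeats w in eq
    ... | true  = ≡.trans (⟦⟧-normalise T m) (≡.sym (≡.trans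
            (cong (λ z → c * z + ⟦ T ⟧ g m) (power-0 X a (power-0 Y b (repeats-0 w eq)) m))
            (≡.trans (cong (λ z → z + ⟦ T ⟧ g m) (ℤ.*-zeroʳ c)) (ℤ.+-identityˡ _))))
    ... | false = ≡.trans (⟦⟧-insert c (a , b , canonical ord w) (normalise ord T) g m)
            (cong₂ (λ x y → c * x + y) (power-cong X a (power-cong Y b (canonical-≗ w)) m) (⟦⟧-normalise T m))

    ⟦⟧-vanishes : ∀ T → vanishes T ≡ true → ⟦ T ⟧ g ≗ (λ _ → + 0)
    ⟦⟧-vanishes []            p m = refl
    ⟦⟧-vanishes ((c , k) ∷ T) p m with c ℤ.≟ + 0
    ... | yes refl = ≡.trans (ℤ.+-identityˡ _) (⟦⟧-vanishes T p m)
    ⟦⟧-vanishes ((c , k) ∷ T) () m | no _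

    ⟦⟧-equal : ∀ S T → vanishes (normalise ord (S ++ negateTerms T)) ≡ true → ⟦ S ⟧ g ≗ ⟦ T ⟧ g
    ⟦⟧-equal S T p m = ℤ.i-j≡0⇒i≡j (⟦ S ⟧ g m) (⟦ T ⟧ g m) (≡.trans
      (cong (λ z → ⟦ S ⟧ g m + z) (≡.sym (⟦⟧-negate T g m)))
      (≡.trans (≡.sym (⟦⟧-++ S (negateTerms T) g m))
        (≡.trans (≡.sym (⟦⟧-normalise (S ++ negateTerms T) m)) (⟦⟧-vanishes (normalise ord (S ++ negateTerms T)) p m))))

-- Invariance of the expansion under the Coxeter relations

module BraidInvariance {n : ℕ} (A : Matrix n) (gcm : IsGCM A) where
  open GCM A gcm
  open Positivity A gcm
  open Expansion A gcm

  module _ (i j : Fin n) (p₀ : Word n) where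
    private
      X Y : Lattice n
      X = act A p₀ (e i)
      Y = act A p₀ (e j)
    open Semantics X Y

    letter : Bool → Fin n
    letter true  = i
    letter false = j

    linear : LinearForm → Lattice n
    linear (p , q) = comb p X q Y

    private
      lin-step : ∀ (p q p′ q′ c x y : ℤ) →
        + 1 * (p * x + q * y) + - c * (p′ * x + q′ * y) ≡ (p - c * p′) * x + (q - c * q′) * y
      lin-step = solve-∀
      refl-comb : ∀ (x c z : ℤ) → x - c * z ≡ + 1 * x + - c * z
      refl-comb = solve-∀

    image-snoc : ∀ q h k {ξ η c} → act A q (e h) ≗ linear ξ → act A q (e k) ≗ linear η → A h k ≡ c →
      act A (q ++ h ∷ []) (e k) ≗ linear (subtract η c ξ)
    image-snoc q h k {ξ} {η} {c} qh qk refl g = ≡.trans (cong (λ f → f g) (act-++ A q (h ∷ []) (e k)))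
      (≡.trans
        (act-cong A q (λ l → ≡.trans (cong (λ z → e k l - z * e h l) (pair-e A h k)) (refl-comb (e k l) c (e h l))) g)
        (≡.trans (act-comb A q (+ 1) (e k) (- c) (e h) g)
          (≡.trans (cong₂ (λ s t → + 1 * s + - c * t) (qk g) (qh g))
            (lin-step (proj₁ η) (proj₂ η) (proj₁ ξ) (proj₂ ξ) c (X g) (Y g)))))

    -- The coefficient belonging to T_w: the tail `γ` expanded after the letters `w` have been
    -- chosen in the rank 2 part.
    remainder : Word n → Word n → (Word n → ℤ) → List Bool → Coeffs n
    remainder q γ φ w = expand q γ (λ z → φ (map letter w ++ z))

    expand-step : ∀ h r q γ φ ζ T → act A q (e (letter h)) ≗ linear ζ →
      (∀ φ → expand (q ++ letter h ∷ []) (map letter r ++ γ) φ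
        ≗ ⟦ T ⟧ (remainder ((q ++ letter h ∷ []) ++ map letter r) γ φ)) →
      expand q (map letter (h ∷ r) ++ γ) φ
        ≗ ⟦ T ++ mulLinear ζ (prepend h T) ⟧ (remainder (q ++ map letter (h ∷ r)) γ φ)
    expand-step h r q γ φ ζ T qh rec m
      rewrite ≡.sym (++-assoc q (letter h ∷ []) (map letter r)) = ≡.trans
      (cong₂ _+_ (rec φ m) (lmul-cong qh (rec (λ x → φ (letter h ∷ x))) m))
      (≡.sym (≡.trans (⟦⟧-++ T (mulLinear ζ (prepend h T)) g m)
        (cong (λ z → ⟦ T ⟧ g m + z)
          (≡.trans (⟦⟧-mulLinear (proj₁ ζ) (proj₂ ζ) (prepend h T) g m)
            (lmul-cong {μ = linear ζ} (λ _ → refl) (⟦⟧-prepend h T g) m)))))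
      where
      g : List Bool → Coeffs n
      g = remainder ((q ++ letter h ∷ []) ++ map letter r) γ φ

    expand-symbolic : ∀ r q γ φ ξ η → act A q (e i) ≗ linear ξ → act A q (e j) ≗ linear η →
      expand q (map letter r ++ γ) φ ≗ ⟦ symbolic (A i j) (A j i) ξ η r ⟧ (remainder (q ++ map letter r) γ φ)
    expand-symbolic [] q γ φ ξ η qi qj m = ≡.trans
      (cong (λ q → expand q γ φ m) (≡.sym (++-identityʳ q)))
      (≡.sym (≡.trans (ℤ.+-identityʳ _) (ℤ.*-identityˡ _)))
    expand-symbolic (true ∷ r) q γ φ ξ η qi qj = expand-step true r q γ φ ξ
      (symbolic (A i j) (A j i) (subtract ξ (+ 2) ξ) (subtract η (A i j) ξ) r) qi λ φ′ →
      expand-symbolic r (q ++ i ∷ []) γ φ′ (subtract ξ (+ 2) ξ) (subtract η (A i j) ξ)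
        (image-snoc q i i {ξ} {ξ} qi qi (proj₁ gcm i)) (image-snoc q i j {ξ} {η} qi qj refl)
    expand-symbolic (false ∷ r) q γ φ ξ η qi qj = expand-step false r q γ φ η
      (symbolic (A i j) (A j i) (subtract ξ (A j i) η) (subtract η (+ 2) η) r) qj λ φ′ →
      expand-symbolic r (q ++ j ∷ []) γ φ′ (subtract ξ (A j i) η) (subtract η (+ 2) η)
        (image-snoc q j i {η} {ξ} qj qi refl) (image-snoc q j j {η} {η} qj qj (proj₁ gcm j))

    map-alternating : ∀ g h k → map letter (alternating g h k) ≡ alternating (letter g) (letter h) k
    map-alternating g h zero    = refl
    map-alternating g h (suc k) = cong (letter g ∷_) (map-alternating h g k)

    remainder-nilCoxeter : ∀ q γ {φ k} → NilCoxeter φ → i ≢ j → order i j ≡ just k →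
      NilCoxeterMap k (remainder q γ φ)
    remainder-nilCoxeter q γ {φ} {k} N i≢j ord = record { repeats-0 = zero-at ; alternating-≗ = same }
      where
      zero-at : ∀ w → repeats w ≡ true → remainder q γ φ w ≗ (λ _ → + 0)
      zero-at (h₀ ∷ w) p with repeats-split h₀ w p
      ... | x , h , y , eq = expand-0 q γ λ z → ≡.trans
        (cong φ (≡.trans (cong (_++ z) (≡.trans (cong (map letter) eq) (map-++ letter x (h ∷ h ∷ y))))
          (++-assoc (map letter x) (letter h ∷ letter h ∷ map letter y) z)))
        (N .square-0 (map letter x) (letter h) (map letter y ++ z))
      same : remainder q γ φ (alternating true false k) ≗ remainder q γ φ (alternating false true k)
      same = expand-cong {q} {q} γ (λ _ _ → refl) λ z → ≡.trans
        (cong (λ w → φ (w ++ z)) (map-alternating true false k))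
        (≡.trans (N .braid-≡ [] z i≢j ord)
          (cong (λ w → φ (w ++ z)) (≡.sym (map-alternating false true k))))

    private
      is-X : ∀ (x y : ℤ) → x ≡ + 1 * x + + 0 * y
      is-X = solve-∀
      is-Y : ∀ (x y : ℤ) → y ≡ + 0 * x + + 1 * y
      is-Y = solve-∀

    expand-braid : ∀ γ {φ k} → NilCoxeter φ → i ≢ j → order i j ≡ just k →
      expand p₀ (alternating i j k ++ γ) φ ≗ expand p₀ (alternating j i k ++ γ) φ
    expand-braid γ {φ} {k} N i≢j ord m = ≡.trans (start true false)
      (≡.trans (⟦⟧-equal (remainder-nilCoxeter (p₀ ++ map letter (alternating true false k)) γ N i≢j ord)
                  (terms true false) (terms false true) check m)
        (≡.trans (⟦⟧-cong (terms false true) same m) (≡.sym (start false true))))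
      where
      terms : Bool → Bool → Terms
      terms g h = symbolic (A i j) (A j i) (+ 1 , + 0) (+ 0 , + 1) (alternating g h k)
      start : ∀ g h → expand p₀ (alternating (letter g) (letter h) k ++ γ) φ m ≡
        ⟦ terms g h ⟧ (remainder (p₀ ++ map letter (alternating g h k)) γ φ) m
      start g h = ≡.trans (cong (λ w → expand p₀ (w ++ γ) φ m) (≡.sym (map-alternating g h k)))
        (expand-symbolic (alternating g h k) p₀ γ φ (+ 1 , + 0) (+ 0 , + 1)
          (λ l → is-X (X l) (Y l)) (λ l → is-Y (X l) (Y l)) m)
      check : vanishes (normalise k (terms true false ++ negateTerms (terms false true))) ≡ true
      check = subst₂
        (λ a b → vanishes (normalise k
          (symbolic a b (+ 1 , + 0) (+ 0 , + 1) (alternating true false k)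
            ++ negateTerms (symbolic a b (+ 1 , + 0) (+ 0 , + 1) (alternating false true k)))) ≡ true)
        (≡.sym (offdiag i j i≢j)) (≡.sym (offdiag j i (λ p → i≢j (≡.sym p)))) (yang-baxter (rank2 i≢j ord))
      -- The two halves of the braid end at the same alcove, so the tail carries the same labels
      -- after either.
      same : ∀ w → remainder (p₀ ++ map letter (alternating true false k)) γ φ w
        ≗ remainder (p₀ ++ map letter (alternating false true k)) γ φ w
      same w = expand-cong γ
        (act-~ (~-++ˡ A p₀ (trans (≡⇒~ A (map-alternating true false k))
          (trans (braid-~ i≢j ord) (≡⇒~ A (≡.sym (map-alternating false true k)))))))
        (λ _ → refl)

  expand-reverse : ∀ p u γ {φ} → NilCoxeter φ → expand p (u ++ reverse u ++ γ) φ ≗ expand p γ φ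
  expand-reverse p []      γ N m = refl
  expand-reverse p (i ∷ u) γ {φ} N m = ≡.trans
    (cong (λ w → expand p (i ∷ u ++ w) φ m)
      (≡.trans (cong (_++ γ) (unfold-reverse i u)) (++-assoc (reverse u) (i ∷ []) γ)))
    (≡.trans (expand-prefix p (i ∷ []) (u ++ reverse u ++ i ∷ γ) (i ∷ γ) (expand-reverse (p ++ i ∷ []) u (i ∷ γ)) N m)
      (expand-square p i γ N m))

  -- A braid relator is one alternating word followed by the inverse of the other. Once its first
  -- half is exchanged, the walk retraces its own steps.
  expand-relator : ∀ p {r} γ → Relator A r → ∀ {φ} → NilCoxeter φ → expand p (r ++ γ) φ ≗ expand p γ φ
  expand-relator p γ (square i) N = expand-square p i γ N
  expand-relator p γ (braid i j k i≢j ord) {φ} N m = ≡.trans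
    (cong (λ w → expand p w φ m)
      (≡.trans (cong (_++ γ) (relator-halves ord i j)) (++-assoc (alternating i j k) _ γ)))
    (≡.trans (expand-braid i j p (reverse (alternating j i k) ++ γ) N i≢j ord m)
      (expand-reverse p (alternating j i k) γ N m))

  expand-~ : ∀ {x y} → Equiv A x y → ∀ {φ} → NilCoxeter φ → expand [] x φ ≗ expand [] y φ
  expand-~ (rel u v {r} R) N m = expand-prefix [] u (r ++ v) v (expand-relator u v R) N m
  expand-~ refl        N m = refl
  expand-~ (sym p)     N m = ≡.sym (expand-~ p N m)
  expand-~ (trans p q) N m = ≡.trans (expand-~ p N m) (expand-~ q N m)

-- Convolution on exponent functions compared with coefficient vectors

module _ {X : Set} where

  Σˡ : List X → (X → ℤ) → ℤ
  Σˡ L f = sumList (map f L)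

  Σˡ-cong : ∀ L {f g : X → ℤ} → f ≗ g → Σˡ L f ≡ Σˡ L g
  Σˡ-cong []      p = refl
  Σˡ-cong (x ∷ L) p = cong₂ _+_ (p x) (Σˡ-cong L p)

  Σˡ-0 : ∀ L {f : X → ℤ} → f ≗ (λ _ → + 0) → Σˡ L f ≡ + 0
  Σˡ-0 []      p = refl
  Σˡ-0 (x ∷ L) p = cong₂ _+_ (p x) (Σˡ-0 L p)

  private
    exchange : ∀ (a b c d : ℤ) → (a + b) + (c + d) ≡ (a + c) + (b + d)
    exchange = solve-∀

  Σˡ-+ : ∀ L (f g : X → ℤ) → Σˡ L (λ x → f x + g x) ≡ Σˡ L f + Σˡ L g
  Σˡ-+ []      f g = refl
  Σˡ-+ (x ∷ L) f g = ≡.trans (cong (λ z → (f x + g x) + z) (Σˡ-+ L f g)) (exchange (f x) (g x) _ _)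

  Σˡ-++ : ∀ L M (f : X → ℤ) → Σˡ (L ++ M) f ≡ Σˡ L f + Σˡ M f
  Σˡ-++ []      M f = ≡.sym (ℤ.+-identityˡ _)
  Σˡ-++ (x ∷ L) M f = ≡.trans (cong (λ z → f x + z) (Σˡ-++ L M f)) (≡.sym (ℤ.+-assoc (f x) _ _))

Σˡ-concatMap : ∀ {X Y : Set} (G : Y → List X) L (f : X → ℤ) → Σˡ (concatMap G L) f ≡ Σˡ L (λ y → Σˡ (G y) f)
Σˡ-concatMap G []      f = refl
Σˡ-concatMap G (y ∷ L) f = ≡.trans (Σˡ-++ (G y) (concatMap G L) f) (cong (λ z → Σˡ (G y) f + z) (Σˡ-concatMap G L f))

Σˡ-map : ∀ {X Y : Set} (h : Y → X) L (f : X → ℤ) → Σˡ (map h L) f ≡ Σˡ L (λ y → f (h y))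
Σˡ-map h []      f = refl
Σˡ-map h (y ∷ L) f = cong (λ z → f (h y) + z) (Σˡ-map h L f)

Σˡ-applyUpTo-0 : ∀ {X : Set} (h : ℕ → X) k (f : X → ℤ) → (∀ l → f (h l) ≡ + 0) → Σˡ (applyUpTo h k) f ≡ + 0
Σˡ-applyUpTo-0 h zero    f p = refl
Σˡ-applyUpTo-0 h (suc k) f p = cong₂ _+_ (p 0) (Σˡ-applyUpTo-0 (λ l → h (suc l)) k f (λ l → p (suc l)))

indicator : Bool → ℤ
indicator b = if b then + 1 else + 0

-- The coefficient at m of the product of q with the monomial of exponent b.
convolve : ∀ n → Exp n → Coeffs n → Exp n → ℤ
convolve n b q m = Σˡ (below n m) (λ a → indicator (eqExp a b) * q (tabulate (λ j → m j ℕ.∸ a j)))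

convolve-suc : ∀ n b (q : Coeffs (suc n)) m → convolve (suc n) b q m ≡
  Σˡ (applyUpTo (λ k → k) (suc (m zero))) (λ k → Σˡ (below n (VF.tail m)) (λ a →
    indicator (does (k ℕ.≟ b zero) ∧ eqExp a (VF.tail b)) *
      q ((m zero ℕ.∸ k) ∷ tabulate (λ j → m (suc j) ℕ.∸ a j))))
convolve-suc n b q m = ≡.trans
  (Σˡ-concatMap (λ k → map (λ a → k VF.∷ a) (below n (VF.tail m))) (applyUpTo (λ k → k) (suc (m zero))) F)
  (Σˡ-cong (applyUpTo (λ k → k) (suc (m zero))) (λ k → Σˡ-map (λ a → k VF.∷ a) (below n (VF.tail m)) F))
  where
  F : Exp (suc n) → ℤ
  F a = indicator (eqExp a b) * q (tabulate (λ j → m j ℕ.∸ a j))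

convolve-one : ∀ n (q : Coeffs n) m → convolve n (λ _ → 0) q m ≡ q (tabulate m)
convolve-one zero    q m = ≡.trans (ℤ.+-identityʳ _) (ℤ.*-identityˡ _)
convolve-one (suc n) q m = ≡.trans (convolve-suc n (λ _ → 0) q m)
  (≡.trans
    (cong₂ _+_ (convolve-one n (λ m′ → q (m zero ∷ m′)) (VF.tail m))
      (Σˡ-applyUpTo-0 suc (m zero) _ (λ l → Σˡ-0 (below n (VF.tail m)) (λ a → refl))))
    (ℤ.+-identityʳ _))

convolve-unit : ∀ n j (q : Coeffs n) m → convolve n (unitExp j) q m ≡ shift j q (tabulate m)
convolve-unit (suc n) zero q m = ≡.trans (convolve-suc n (unitExp zero) q m)
  (≡.trans (cong (λ z → z + Σˡ (applyUpTo suc (m zero)) G) (Σˡ-0 (below n (VF.tail m)) (λ a → refl)))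
    (≡.trans (ℤ.+-identityˡ _) (rest (m zero) refl)))
  where
  G : ℕ → ℤ
  G k = Σˡ (below n (VF.tail m)) (λ a →
    indicator (does (k ℕ.≟ 1) ∧ eqExp a (λ _ → 0)) * q ((m zero ℕ.∸ k) ∷ tabulate (λ j → m (suc j) ℕ.∸ a j)))
  -- Only k = 1 contributes. For M = 0 the range is empty, in agreement with the value 0 of `shift`.
  rest : ∀ M → m zero ≡ M → Σˡ (applyUpTo suc M) G ≡ shift zero q (M ∷ tabulate (VF.tail m))
  rest zero    eq = refl
  rest (suc M) eq = ≡.trans
    (cong₂ _+_ (convolve-one n (λ m′ → q ((m zero ℕ.∸ 1) ∷ m′)) (VF.tail m))
      (Σˡ-applyUpTo-0 (λ l → suc (suc l)) M G (λ l → Σˡ-0 (below n (VF.tail m)) (λ a → refl))))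
    (≡.trans (ℤ.+-identityʳ _) (cong (λ z → q ((z ℕ.∸ 1) ∷ tabulate (VF.tail m))) eq))
convolve-unit (suc n) (suc j) q m = ≡.trans (convolve-suc n (unitExp (suc j)) q m)
  (≡.trans
    (cong₂ _+_ (convolve-unit n j (λ m′ → q (m zero ∷ m′)) (VF.tail m))
      (Σˡ-applyUpTo-0 suc (m zero) _ (λ l → Σˡ-0 (below n (VF.tail m)) (λ a → refl))))
    (ℤ.+-identityʳ _))

private
  if-indicator : ∀ b (x : ℤ) → (if b then x else + 0) ≡ x * indicator b
  if-indicator true  x = ≡.sym (ℤ.*-identityʳ x)
  if-indicator false x = ≡.sym (ℤ.*-zeroʳ x)

sumFin-Σˡ : ∀ {X : Set} n (L : List X) (μ : Fin n → ℤ) (c : Fin n → X → ℤ) (f : X → ℤ) →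
  Σˡ L (λ a → sumFin n (λ j → μ j * c j a) * f a) ≡ sumFin n (λ j → μ j * Σˡ L (λ a → c j a * f a))
sumFin-Σˡ n []      μ c f = ≡.sym (≡.trans (sumFin-cong n (λ j → ℤ.*-zeroʳ (μ j))) (sumFin-0 n))
sumFin-Σˡ n (a ∷ L) μ c f = ≡.trans
  (cong₂ _+_ (head (f a)) (≡.trans (sumFin-Σˡ n L μ c f) (≡.sym (ℤ.*-identityˡ _))))
  (≡.trans (≡.sym (sumFin-comb n (f a) (+ 1) _ _))
    (sumFin-cong n (λ j → rearrange (f a) (μ j) (c j a) (Σˡ L (λ a → c j a * f a)))))
  where
  head : ∀ x → sumFin n (λ j → μ j * c j a) * x ≡ x * sumFin n (λ j → μ j * c j a)
  head x = ℤ.*-comm _ x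
  rearrange : ∀ (x u v s : ℤ) → x * (u * v) + + 1 * (u * s) ≡ u * (v * x + s)
  rearrange = solve-∀

linP-⊛ : ∀ {n} (μ : Lattice n) {q : Poly n} {q′ : Coeffs n} → (∀ m → q m ≡ q′ (tabulate m)) →
  ∀ m → (linP μ ⊛ q) m ≡ lmul μ q′ (tabulate m)
linP-⊛ {n} μ {q} {q′} q≡ m = ≡.trans
  (Σˡ-cong (below n m) (λ a → cong₂ _*_
    (sumFin-cong n (λ j → if-indicator (eqExp a (unitExp j)) (μ j))) (q≡ (λ j → m j ℕ.∸ a j))))
  (≡.trans (sumFin-Σˡ n (below n m) μ (λ j a → indicator (eqExp a (unitExp j))) _)
    (sumFin-cong n (λ j → cong (μ j *_) (convolve-unit n j q′ m))))

oneP-one : ∀ {n} (m : Exp n) → oneP m ≡ one (tabulate m)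
oneP-one {zero}  m = refl
oneP-one {suc n} m with m zero
... | zero  = oneP-one (VF.tail m)
... | suc _ = refl

psi : ∀ {n} → List (Lattice n) → List Bool → Coeffs n
psi (β ∷ bs) (true  ∷ ε) = lmul β (psi bs ε)
psi (β ∷ bs) (false ∷ ε) = psi bs ε
psi []       _           = one
psi (_ ∷ _)  []          = one

PsiMask-psi : ∀ {n} (bs : List (Lattice n)) ε m → PsiMask bs ε m ≡ psi bs ε (tabulate m)
PsiMask-psi (β ∷ bs) (true  ∷ ε) m = linP-⊛ β (PsiMask-psi bs ε) m
PsiMask-psi (β ∷ bs) (false ∷ ε) m = PsiMask-psi bs ε m
PsiMask-psi []       _           m = oneP-one m
PsiMask-psi (_ ∷ _)  []          m = oneP-one m

length-maskWord : ∀ {n} (γ : Word n) ε → length ε ≡ length γ → length (maskWord γ ε) ≡ weight ε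
length-maskWord []      []          p = refl
length-maskWord (i ∷ γ) (true  ∷ ε) p = cong suc (length-maskWord γ ε (ℕ.suc-injective p))
length-maskWord (i ∷ γ) (false ∷ ε) p = length-maskWord γ ε (ℕ.suc-injective p)

allMasks-length : ∀ k → All (λ ε → length ε ≡ k) (allMasks k)
allMasks-length zero    = refl ∷ []
allMasks-length (suc k) = extend (allMasks-length k)
  where
  extend : ∀ {L} → All (λ ε → length ε ≡ k) L →
    All (λ ε → length ε ≡ suc k) (concatMap (λ ε → (false ∷ ε) ∷ (true ∷ ε) ∷ []) L)
  extend []       = []
  extend (p ∷ ps) = cong suc p ∷ cong suc p ∷ extend ps

-- Mask sums as expansions, and the divisibility

module Main {n : ℕ} (A : Matrix n) (gcm : IsGCM A) where
  open GCM A gcm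
  open Positivity A gcm
  open WordProblem A gcm
  open Expansion A gcm
  open BraidInvariance A gcm

  private
    scale : ∀ (c x s : ℤ) → c * x + + 1 * s ≡ c * x + s
    scale = solve-∀

  lmul-Σˡ : ∀ {X : Set} β (L : List X) (c : X → ℤ) (f : X → Coeffs n) m →
    Σˡ L (λ x → c x * lmul β (f x) m) ≡ lmul β (λ m → Σˡ L (λ x → c x * f x m)) m
  lmul-Σˡ β []      c f m = ≡.sym (lmul-0 β (λ _ → refl) m)
  lmul-Σˡ β (x ∷ L) c f m = ≡.trans (cong (λ z → c x * lmul β (f x) m + z) (lmul-Σˡ β L c f m))
    (≡.trans (≡.sym (scale (c x) (lmul β (f x) m) _))
      (≡.trans (≡.sym (lmul-comb β (c x) (f x) (+ 1) rest m))
        (lmul-cong {μ = β} (λ _ → refl) (λ m → scale (c x) (f x m) (rest m)) m)))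
    where
    rest : Coeffs n
    rest m = Σˡ L (λ x → c x * f x m)

  masks-expand : ∀ {p γ bs} → LabelsFrom A p γ bs → ∀ φ m →
    Σˡ (allMasks (length γ)) (λ ε → φ (maskWord γ ε) * psi bs ε m) ≡ expand p γ φ m
  masks-expand done φ m = ℤ.+-identityʳ _
  masks-expand {p} {i ∷ γ} {β ∷ bs} (step label rest) φ m = ≡.trans
    (Σˡ-concatMap (λ ε → (false ∷ ε) ∷ (true ∷ ε) ∷ []) M (λ ε → φ (maskWord (i ∷ γ) ε) * psi (β ∷ bs) ε m))
    (≡.trans
      (Σˡ-cong M (λ ε → cong (λ z → φ (maskWord γ ε) * psi bs ε m + z)
        (ℤ.+-identityʳ (φ (i ∷ maskWord γ ε) * lmul β (psi bs ε) m))))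
      (≡.trans (Σˡ-+ M (λ ε → φ (maskWord γ ε) * psi bs ε m) _)
        (cong₂ _+_ (masks-expand rest φ m)
          (≡.trans (lmul-Σˡ β M (λ ε → φ (i ∷ maskWord γ ε)) (psi bs) m)
            (lmul-cong (label-root label) (masks-expand rest (λ x → φ (i ∷ x))) m)))))
    where
    M : List (List Bool)
    M = allMasks (length γ)

  reducedWordOf? : ∀ k v x → Dec (length x ≡ k × Equiv A x v)
  reducedWordOf? k v x = (length x ℕ.≟ k) ×-dec (x ~? v)

  -- For k = ℓ(v) this is the indicator of the reduced words of v, which extracts the coefficient of
  -- T_v.
  χ : ℕ → Word n → Word n → ℤ
  χ k v x = indicator (does (reducedWordOf? k v x))

  χ-cong : ∀ k v x y → (length x ≡ k × Equiv A x v) ⇔ (length y ≡ k × Equiv A y v) → χ k v x ≡ χ k v y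
  χ-cong k v x y p = cong indicator (does-⇔ p (reducedWordOf? k v x) (reducedWordOf? k v y))

  χ-yes : ∀ k v x → length x ≡ k → Equiv A x v → χ k v x ≡ + 1
  χ-yes k v x p q = cong indicator (dec-true (reducedWordOf? k v x) (p , q))

  χ-no : ∀ k v x → ¬ (length x ≡ k × Equiv A x v) → χ k v x ≡ + 0
  χ-no k v x ¬p = cong indicator (dec-false (reducedWordOf? k v x) ¬p)

  -- A word with a repeated letter is not reduced, and a braid move changes neither length nor group
  -- element.
  χ-nilCoxeter : ∀ {k v} → IsLength A v k → NilCoxeter (χ k v)
  χ-nilCoxeter {k} {v} (_ , min) .square-0 x i y = χ-no k v (x ++ i ∷ i ∷ y) λ { (refl , xiiy~v) → ℕ.<⇒≱ shorter
    (min (x ++ y) (trans (sym (cancel-square A x i y)) xiiy~v)) }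
    where
    shorter : length (x ++ y) ℕ.< length (x ++ i ∷ i ∷ y)
    shorter = subst₂ ℕ._<_ (≡.sym (length-++ x)) (≡.sym (length-++ x))
      (ℕ.+-monoʳ-< (length x) (ℕ.<-trans (ℕ.n<1+n _) (ℕ.n<1+n _)))
  χ-nilCoxeter {k} {v} _ .braid-≡ x {i} {j} {m} y i≢j ord = χ-cong k v
    (x ++ alternating i j m ++ y) (x ++ alternating j i m ++ y) (mk⇔
    (λ (p , q) → ≡.trans (≡.sym lengths) p , trans (sym swap) q)
    (λ (p , q) → ≡.trans lengths p , trans swap q))
    where
    swap : Equiv A (x ++ alternating i j m ++ y) (x ++ alternating j i m ++ y)
    swap = ~-++ˡ A x (~-++ʳ A y (braid-~ i≢j ord))
    len : ∀ i j → length (x ++ alternating i j m ++ y) ≡ length x ℕ.+ (m ℕ.+ length y)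
    len i j = ≡.trans (length-++ x) (cong (length x ℕ.+_)
      (≡.trans (length-++ (alternating i j m)) (cong (ℕ._+ length y) (length-alternating i j m))))
    lengths : length (x ++ alternating i j m ++ y) ≡ length (x ++ alternating j i m ++ y)
    lengths = ≡.trans (len i j) (≡.sym (len j i))

  -- `SumRel` tests the weight of a mask and `χ` the length of its word; these agree since the mask
  -- is as long as the walk.
  SumRel-Σˡ : ∀ {γ bs v k εs p} → All (λ ε → length ε ≡ length γ) εs → SumRel A γ bs v k εs p →
    ∀ m → p m ≡ Σˡ εs (λ ε → χ k v (maskWord γ ε) * psi bs ε (tabulate m))
  SumRel-Σˡ []       nil m = refl
  SumRel-Σˡ {γ} {bs} {v} {k} {ε ∷ _} (l ∷ ls) (take w q S) m = cong₂ _+_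
    (≡.trans (PsiMask-psi bs ε m) (≡.sym (≡.trans
      (cong (λ z → z * psi bs ε (tabulate m))
        (χ-yes k v (maskWord γ ε) (≡.trans (length-maskWord γ ε l) w) q))
      (ℤ.*-identityˡ _))))
    (SumRel-Σˡ ls S m)
  SumRel-Σˡ {γ} {bs} {v} {k} {ε ∷ _} (l ∷ ls) (skip ¬wq S) m = ≡.trans (SumRel-Σˡ ls S m)
    (≡.sym (≡.trans
      (cong (λ z → z * psi bs ε (tabulate m) + _)
        (χ-no k v (maskWord γ ε) λ (p , q) → ¬wq (≡.trans (≡.sym (length-maskWord γ ε l)) p , q)))
      (ℤ.+-identityˡ _)))

  PsiSum-expand : ∀ {γ bs v k p} → Labels A γ bs → PsiSum A γ bs v k p →
    ∀ m → p m ≡ expand [] γ (χ k v) (tabulate m)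
  PsiSum-expand {γ} {v = v} {k} labels S m = ≡.trans (SumRel-Σˡ (allMasks-length (length γ)) S m)
    (masks-expand labels (χ k v) (tabulate m))

  private
    flip : ∀ (x y : ℤ) → - (+ 1) * (+ 1 * x + - (+ 1) * y) + + 0 * (+ 1 * x + - (+ 1) * y) ≡ y - x
    flip = solve-∀

  psi-divides : ∀ v w u i γ → Equiv A γ w → ∀ bs → Labels A γ bs →
    ∀ γ′ → Equiv A γ′ (reflWord u i ++ w) → ∀ bs′ → Labels A γ′ bs′ →
    ∀ k → IsLength A v k → ∀ p p′ → PsiSum A γ bs v k p → PsiSum A γ′ bs′ v k p′ →
    Divides (act A u (e i)) (p ⊖ p′)
  psi-divides v w u i γ γ~w bs labels γ′ γ′~ bs′ labels′ k len p p′ S S′ =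
    (λ m → quotient (tabulate m)) ,
    (degree , λ m (j , lt) → bounded (tabulate m) j (subst (degree ℕ.<_) (≡.sym (lookup∘tabulate m j)) lt)) ,
    λ m → ≡.trans (difference m)
      (≡.trans (equation (tabulate m)) (≡.sym (linP-⊛ β (λ _ → refl) m)))
    where
    φ : Word n → ℤ
    φ = χ k v
    N : NilCoxeter φ
    N = χ-nilCoxeter len
    β : Lattice n
    β = act A u (e i)
    F G : Coeffs n
    F = expand [] (u ++ i ∷ reverse u ++ w) φ
    G = expand [] (u ++ reverse u ++ w) φ
    β∣F⊝G : DividesC β (F ⊝ G)
    β∣F⊝G = expand-prefix-mod [] u (i ∷ reverse u ++ w) (reverse u ++ w) (expand-reflect u i (reverse u ++ w)) φ
    -- The coefficients - 1 and 0 reverse the sign: `F` belongs to s_β w and `G` to w, while the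
    -- claim concerns G - F.
    open DividesC (dividesC-comb (- (+ 1)) (+ 0) β∣F⊝G β∣F⊝G)
    difference : ∀ m → p m - p′ m ≡ combC (- (+ 1)) (F ⊝ G) (+ 0) (F ⊝ G) (tabulate m)
    difference m = ≡.trans
      (cong₂ _-_
        (≡.trans (PsiSum-expand labels S m)
          (expand-~ (trans γ~w (sym (cancel-reverseʳ A u w))) N (tabulate m)))
        (≡.trans (PsiSum-expand labels′ S′ m)
          (expand-~ (trans γ′~ (≡⇒~ A (++-assoc u (i ∷ reverse u) w))) N (tabulate m))))
      (≡.sym (flip (F (tabulate m)) (G (tabulate m))))

theorem4p1 : ∀ (m : ℕ) (A : Matrix (suc m)) → AffineCartanDatum A →
  ∀ (v w : Word (suc m)) (u : Word (suc m)) (i : Fin (suc m)) →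
  -- β = u α_i ∈ R_af,  s_β = u s_i u⁻¹
  -- γ : a walk to w,  γ' : a walk to s_β w
  ∀ (γ : Word (suc m)) → Equiv A γ w →
  ∀ (bs : List (Lattice (suc m))) → Labels A γ bs →
  ∀ (γ' : Word (suc m)) → Equiv A γ' (reflWord u i ++ w) →
  ∀ (bs' : List (Lattice (suc m))) → Labels A γ' bs' →
  ∀ (k : ℕ) → IsLength A v k →
  ∀ (p p' : Poly (suc m)) → PsiSum A γ bs v k p → PsiSum A γ' bs' v k p' →
  Divides (act A u (e i)) (p ⊖ p')
theorem4p1 m A ((gcm , _) , _) = Main.psi-divides A gcm
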